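{- Let $q$ be a prime power and $m\ge 1$. Let $\Sigma_\infty$ be a hyperplane of ${\rm PG}(4m,q)$, $\mathcal S$ a $(2m-1)$-spread of $\Sigma_\infty$ and $\Pi(\mathcal S)$ the associated translation plane (see context). Fix $\mathbf z\in\mathcal S$, an $(m-1)$-dimensional subspace $\mathcal V\subseteq\mathbf z$, and a $(3m-1)$-dimensional subspace $\Gamma\subseteq\Sigma_\infty$ disjoint from $\mathcal V$. For $\mathbf x\in\mathcal S\setminus\{\mathbf z\}$ let $I(\mathbf x)=\langle\mathbf x,\mathcal V\rangle\cap\Gamma$, and $\mathcal I(\mathcal V)=\{I(\mathbf x):\mathbf x\in\mathcal S\setminus\{\mathbf z\}\}$. Let $\Gamma'$ be a $3m$-dimensional subspace of ${\rm PG}(4m,q)$ with $\Gamma'\cap\Sigma_\infty=\Gamma$, and let $\mathcal F(\mathcal V)$ be the set of $2m$-dimensional subspaces of $\Gamma'$ not contained in $\Gamma$ containing some element of $\mathcal I(\mathcal V)$. Let $\mathcal B$ be a minimal $\mathcal F(\mathcal V)$-blocking set of size $q^{2m}$, and let $\mathcal B^*$ be the point set of $\Pi(\mathcal S)$ consisting of all affine points of the subspaces $\langle\mathcal V,P\rangle$, $P\in\mathcal B$, together with the point $\mathbf z$. Then $\mathcal B^*$ is a unital in $\Pi(\mathcal S)$.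
   Context: A $(t-1)$-spread is a set of $(t-1)$-dimensional subspaces partitioning the points. The André/Bruck–Bose plane $\Pi(\mathcal S)$ has as points the affine points of ${\rm PG}(4m,q)$ (those not in $\Sigma_\infty$) and the elements of $\mathcal S$; as lines the $2m$-dimensional subspaces not contained in $\Sigma_\infty$ meeting $\Sigma_\infty$ in an element of $\mathcal S$, plus the line at infinity $\mathcal S$; incidence is containment. It is a projective plane of order $q^{2m}$. An $\mathcal F(\mathcal V)$-blocking set is a set of points of $\Gamma'\setminus\Gamma$ meeting every element of $\mathcal F(\mathcal V)$; it is minimal if through each of its points $P$ some element of $\mathcal F(\mathcal V)$ meets it exactly in $\{P\}$. A unital in a projective plane of order $n^2$ is a set of $n^3+1$ points such that every line meets it in $1$ or $n+1$ points (here $n=q^m$). -}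

module Defs where

open import Level using (0ℓ)
open import Data.Nat using (ℕ; zero; suc) renaming (_+_ to _+ℕ_; _*_ to _*ℕ_; _^_ to _^ℕ_)
open import Data.Bool using (Bool; true; false; if_then_else_; T)
open import Data.Fin using (Fin)
import Data.Fin as Fin
open import Data.Vec using (Vec; []; _∷_; replicate; zipWith; map)
open import Data.List using (List; length)
open import Data.List.Membership.Propositional using (_∈_)
open import Data.List.Relation.Unary.Unique.Propositional using (Unique)
open import Data.Product using (Σ; ∃; _×_; _,_; proj₁)
open import Data.Sum using (_⊎_)
open import Data.Empty using (⊥)
open import Data.Unit using (⊤)
open import Function using (_∘_)
open import Function.Bundles using (_⇔_)
open import Relation.Nullary using (¬_; does)
open import Relation.Binary.PropositionalEquality using (_≡_; _≢_)
open import Relation.Binary.Definitions using (DecidableEquality)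
open import Algebra.Structures using (IsCommutativeRing)

record FiniteField : Set₁ where
  infixl 6 _+_
  infixl 7 _*_
  field
    Carrier    : Set
    _+_ _*_    : Carrier → Carrier → Carrier
    -_         : Carrier → Carrier
    0# 1#      : Carrier
    isCommutativeRing : IsCommutativeRing _≡_ _+_ _*_ -_ 0# 1#
    0≢1        : 0# ≢ 1#
    inverse    : ∀ x → x ≢ 0# → ∃ λ y → x * y ≡ 1#
    _≟_        : DecidableEquality Carrier
    order      : ℕ
    elements   : List Carrier
    elements-unique   : Unique elements
    elements-complete : ∀ x → x ∈ elements
    elements-length   : length elements ≡ order

Card : {X : Set} → (X → Set) → ℕ → Set
Card {X} A k = Σ (List X) λ xs → Unique xs × length xs ≡ k × (∀ x → (x ∈ xs) ⇔ A x)

-- Projective geometry PG(N-1, q): vectors of length N over the field.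

module Geometry (𝔽 : FiniteField) (N : ℕ) where
  open FiniteField 𝔽 renaming (Carrier to F)

  V : Set
  V = Vec F N

  zeroV : V
  zeroV = replicate N 0#

  isNorm : ∀ {k} → Vec F k → Bool
  isNorm []      = false
  isNorm (x ∷ v) = if does (x ≟ 0#) then isNorm v else does (x ≟ 1#)

  -- projective points = normalised representatives of 1-dim subspaces
  Point : Set
  Point = Σ V (T ∘ isNorm)

  vec : Point → V
  vec = proj₁

  -- sets of vectors (subspaces are such sets with a dimension witness)
  VSet : Set₁
  VSet = V → Set

  _⊆_ : VSet → VSet → Set
  A ⊆ B = ∀ v → A v → B v

  _∩_ : VSet → VSet → VSet
  (A ∩ B) v = A v × B v

  join : VSet → VSet → VSet
  join A B v = ∃ λ a → ∃ λ b → A a × B b × v ≡ zipWith _+_ a b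

  ptSpace : Point → VSet
  ptSpace P v = ∃ λ c → v ≡ map (c *_) (vec P)

  lc : ∀ {k} → (Fin k → F) → (Fin k → V) → V
  lc {zero}  c vs = zeroV
  lc {suc k} c vs = zipWith _+_ (map (c Fin.zero *_) (vs Fin.zero))
                                (lc (c ∘ Fin.suc) (vs ∘ Fin.suc))

  Independent : ∀ {k} → (Fin k → V) → Set
  Independent vs = ∀ c → lc c vs ≡ zeroV → ∀ j → c j ≡ 0#

  -- S is a vector subspace of (vector) dimension k,
  -- i.e. a projective subspace of dimension k - 1
  VDim : ℕ → VSet → Set
  VDim k S = Σ (Fin k → V) λ vs → Independent vs × (∀ v → S v ⇔ (∃ λ c → v ≡ lc c vs))

  Disjoint : VSet → VSet → Set
  Disjoint A B = ∀ (P : Point) → ¬ (A (vec P) × B (vec P))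

  record Spread (Σ∞ : VSet) (d : ℕ) : Set₁ where
    field
      size   : ℕ
      elt    : Fin size → VSet
      eltDim : ∀ i → VDim d (elt i)
      eltSub : ∀ i → elt i ⊆ Σ∞
      cover  : ∀ (P : Point) → Σ∞ (vec P) → ∃ λ i → elt i (vec P)
      disj   : ∀ (P : Point) i j → elt i (vec P) → elt j (vec P) → i ≡ j

  -- The André / Bruck–Bose plane Π(𝒮) (here N = 4m+1, d = 2m).
  module Plane (m : ℕ) (Σ∞ : VSet) (𝒮 : Spread Σ∞ (2 *ℕ m)) where
    open Spread 𝒮

    -- points: affine points (inj₁, must lie off Σ∞) and spread elements
    PlanePt : Set
    PlanePt = Point ⊎ Fin size

    ValidPt : PlanePt → Set
    ValidPt (Data.Sum.inj₁ P) = ¬ Σ∞ (vec P)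
    ValidPt (Data.Sum.inj₂ i) = ⊤

    lineAtInf : PlanePt → Set
    lineAtInf (Data.Sum.inj₁ P) = ⊥
    lineAtInf (Data.Sum.inj₂ i) = ⊤

    affLine : VSet → Fin size → PlanePt → Set
    affLine W i (Data.Sum.inj₁ P) = W (vec P)
    affLine W i (Data.Sum.inj₂ j) = j ≡ i

    PiLine : (PlanePt → Set) → Set₁
    PiLine L =
      (∀ x → L x ⇔ lineAtInf x)
      ⊎ (Σ VSet λ W → ∃ λ i →
           VDim (suc (2 *ℕ m)) W × ¬ (W ⊆ Σ∞)
           × (∀ v → (W v × Σ∞ v) ⇔ elt i v)
           × (∀ x → L x ⇔ affLine W i x))

    -- a unital in Π(𝒮) (order n² with n = q^m)
    IsUnital : (PlanePt → Set) → Set₁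
    IsUnital U =
      Card (λ x → ValidPt x × U x) (n ^ℕ 3 +ℕ 1)
      × (∀ L → PiLine L →
           Card (λ x → ValidPt x × U x × L x) 1
           ⊎ Card (λ x → ValidPt x × U x × L x) (n +ℕ 1))
      where n = order ^ℕ m

    I : VSet → VSet → Fin size → VSet
    I 𝒱 Γ x = join (elt x) 𝒱 ∩ Γ

    InF : (z : Fin size) → (𝒱 Γ Γ' : VSet) → VSet → Set
    InF z 𝒱 Γ Γ' W =
      VDim (suc (2 *ℕ m)) W × W ⊆ Γ' × ¬ (W ⊆ Γ)
      × (∃ λ x → x ≢ z × I 𝒱 Γ x ⊆ W)

    MinimalBlocking : (z : Fin size) → (𝒱 Γ Γ' : VSet) → (Point → Set) → Set₁
    MinimalBlocking z 𝒱 Γ Γ' B =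
      (∀ P → B P → Γ' (vec P) × ¬ Γ (vec P))
      × (∀ W → InF z 𝒱 Γ Γ' W → ∃ λ P → B P × W (vec P))
      × (∀ P → B P → Σ VSet λ W → InF z 𝒱 Γ Γ' W × W (vec P)
            × (∀ Q → B Q → W (vec Q) → Q ≡ P))

    BStar : (z : Fin size) → VSet → (Point → Set) → PlanePt → Set
    BStar z 𝒱 B (Data.Sum.inj₁ Q) = ∃ λ P → B P × join 𝒱 (ptSpace P) (vec Q)
    BStar z 𝒱 B (Data.Sum.inj₂ i) = i ≡ z

module Submission where

-- With n = q^m, B* has n³ affine points and one point at infinity in a projective plane
-- of order n², and minimality of B gives a tangent at each of its affine points. So the
-- equality case of the Bruen–Thas bound applies: over all affine lines ℓ,
-- ∑ (|ℓ ∩ B*| - (n + 1))² = n²·n³, while the tangents at the n³ affine points already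
-- contribute n² each; hence every other affine line meets B* in n + 1 points.

open import Defs
import Data.Nat as ℕ
import Data.Nat.Properties as ℕ
open import Data.Nat using (ℕ; zero; suc; _≤_; _<_; z≤n; s≤s)
open import Data.Nat.ListAction using (sum)
open import Data.Nat.Tactic.RingSolver using (solve-∀)
open import Data.Bool using (T; if_then_else_)
open import Data.Bool.Properties using (T-irrelevant)
open import Data.Fin using (Fin; zero; suc)
import Data.Fin as Fin
open import Data.Fin.Properties using (nonZeroIndex)
open import Data.Vec using (Vec; []; _∷_; replicate; zipWith; lookup; tabulate) renaming (map to mapᵛ)
open import Data.Vec.Properties
  using (≡-dec; ∷-injective; ∷-injectiveˡ; ∷-injectiveʳ; zipWith-assoc; zipWith-comm; zipWith-identityˡ;
         zipWith-identityʳ; zipWith-inverseˡ; zipWith-inverseʳ; map-cong; map-∘; map-id; map-const;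
         map-replicate; tabulate∘lookup; lookup∘tabulate; tabulate-cong)
open import Data.List
  using (List; []; _∷_; length; map; filter; allFin; cartesianProductWith; cartesianProduct; _++_)
open import Data.List.Properties using (length-map; length-++; length-tabulate)
open import Data.List.Membership.Propositional using (_∈_; find)
open import Data.List.Membership.Propositional.Properties
  using (∈-map⁺; ∈-map⁻; ∈-cartesianProductWith⁺; ∈-cartesianProductWith⁻; ∈-cartesianProduct⁻; ∈-filter⁺;
         ∈-filter⁻; ∈-++⁺ˡ; ∈-++⁺ʳ; ∈-++⁻; ∈-allFin; ∈-∃++)
import Data.List.Relation.Unary.All as All
open import Data.List.Relation.Unary.All using ([]; _∷_)
open import Data.List.Relation.Unary.AllPairs using ([]; _∷_)
import Data.List.Relation.Unary.Any as Any
open import Data.List.Relation.Unary.Any using (here; there; any?)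
open import Data.List.Relation.Unary.Unique.Propositional using (Unique)
import Data.List.Relation.Unary.Unique.Propositional.Properties as Unique
open import Data.Product using (∃; _×_; _,_; proj₁; proj₂)
import Data.Sum
open import Data.Sum using (_⊎_; inj₁; inj₂)
open import Data.Sum.Properties using (inj₁-injective; inj₂-injective)
open import Data.Unit using (tt)
open import Function using (_∘_; id)
open import Function.Bundles using (_⇔_; mk⇔; Equivalence)
open import Relation.Nullary using (¬_; Dec; yes; no; does; contradiction; ¬?)
open import Relation.Nullary.Decidable using (map′; _×-dec_; decidable-stable)
open import Relation.Unary using (Decidable)
open import Relation.Binary.Definitions using (DecidableEquality)
open import Relation.Binary.PropositionalEquality
open import Algebra.Bundles using (CommutativeRing; AbelianGroup)
open import Algebra.Structures using (IsCommutativeRing)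
import Algebra.Properties.AbelianGroup
import Algebra.Properties.Ring

-- A line of the plane is an arbitrary predicate, so lines are never counted as objects. With a
-- point of `B` as origin, affine points become vectors of `Σ∞`, each spread element becomes a
-- parallelism relation, and a line is addressed by its class `i` together with one of its points
-- `p`. Each line is thus seen n² times, once per affine point, and every total over lines carries a
-- further factor n². The tangents come from projecting from 𝒱. The affine part of B* is a union of
-- cosets of 𝒱. If a member of ℱ(𝒱) on `I(x)` meets `B` only in P, then a line through `x` and a
-- point of the cone over P can meet B* only inside one coset of 𝒱; as 𝒱 lies in `z` and `x ≢ z`, it
-- does so in a single point.

module Counting where
  open import Data.Nat using (suc; pred; _+_; _*_; _≟_; ∣_-_∣)
  open import Data.Nat.Properties hiding (_≟_)

  private
    variable
      A C : Set
      P Q : Set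

  -- Sums and cardinalities of finite lists.

  ⟦_⟧ : Dec P → ℕ
  ⟦ d ⟧ = if does d then 1 else 0

  ⟦⟧-yes : (d : Dec P) → P → ⟦ d ⟧ ≡ 1
  ⟦⟧-yes (yes _) _ = refl
  ⟦⟧-yes (no ¬p) p = contradiction p ¬p

  ⟦⟧-no : (d : Dec P) → ¬ P → ⟦ d ⟧ ≡ 0
  ⟦⟧-no (yes p) ¬p = contradiction p ¬p
  ⟦⟧-no (no _)  _  = refl

  ⟦⟧-cong : (d : Dec P) (d′ : Dec Q) → (P → Q) → (Q → P) → ⟦ d ⟧ ≡ ⟦ d′ ⟧
  ⟦⟧-cong d (yes q) f g = ⟦⟧-yes d (g q)
  ⟦⟧-cong d (no ¬q) f g = ⟦⟧-no d (¬q ∘ f)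

  ∑ : List A → (A → ℕ) → ℕ
  ∑ xs f = sum (map f xs)

  syntax ∑ xs (λ x → e) = ∑[ x ← xs ] e

  module _ {f g : A → ℕ} where

    ∑-cong : ∀ xs → (∀ {x} → x ∈ xs → f x ≡ g x) → ∑ xs f ≡ ∑ xs g
    ∑-cong []       eq = refl
    ∑-cong (x ∷ xs) eq = cong₂ _+_ (eq (here refl)) (∑-cong xs (eq ∘ there))

    ∑-mono : ∀ xs → (∀ {x} → x ∈ xs → f x ≤ g x) → ∑ xs f ≤ ∑ xs g
    ∑-mono []       le = z≤n
    ∑-mono (x ∷ xs) le = +-mono-≤ (le (here refl)) (∑-mono xs (le ∘ there))

    ∑-+ : ∀ xs → ∑[ x ← xs ] (f x + g x) ≡ ∑ xs f + ∑ xs g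
    ∑-+ []       = refl
    ∑-+ (x ∷ xs) rewrite ∑-+ xs = lemma (f x) (g x) (∑ xs f) (∑ xs g)
      where
      lemma : ∀ a b c d → a + b + (c + d) ≡ a + c + (b + d)
      lemma = solve-∀

    ∑-tight : ∀ {xs} → (∀ {x} → x ∈ xs → f x ≤ g x) → ∑ xs g ≤ ∑ xs f →
              ∀ {x} → x ∈ xs → f x ≡ g x
    ∑-tight {x ∷ xs} le ge (here refl) =
      ≤-antisym (le (here refl))
        (+-cancelʳ-≤ (∑ xs f) (g x) (f x)
          (≤-trans (+-monoʳ-≤ (g x) (∑-mono xs (le ∘ there))) ge))
    ∑-tight {x ∷ xs} le ge (there x∈) =
      ∑-tight (le ∘ there)
        (+-cancelˡ-≤ (f x) (∑ xs g) (∑ xs f)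
          (≤-trans (+-monoˡ-≤ (∑ xs g) (le (here refl))) ge)) x∈

  ∑-*ˡ : ∀ c {f : A → ℕ} xs → ∑[ x ← xs ] (c * f x) ≡ c * ∑ xs f
  ∑-*ˡ c []       = sym (*-zeroʳ c)
  ∑-*ˡ c {f} (x ∷ xs) rewrite ∑-*ˡ c {f} xs = sym (*-distribˡ-+ c (f x) (∑ xs f))

  ∑-const : ∀ c (xs : List A) → ∑[ _ ← xs ] c ≡ length xs * c
  ∑-const c []       = refl
  ∑-const c (x ∷ xs) = cong (c +_) (∑-const c xs)

  ∑-swap : ∀ (f : A → C → ℕ) xs ys →
           ∑[ x ← xs ] ∑[ y ← ys ] f x y ≡ ∑[ y ← ys ] ∑[ x ← xs ] f x y
  ∑-swap f []       ys = sym (trans (∑-const 0 ys) (*-zeroʳ (length ys)))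
  ∑-swap f (x ∷ xs) ys rewrite ∑-swap f xs ys = sym (∑-+ ys)

  ∑-member : ∀ {f : A → ℕ} {xs x} → x ∈ xs → f x ≤ ∑ xs f
  ∑-member (here refl) = m≤m+n _ _
  ∑-member {f = f} {xs = y ∷ _} (there x∈) = ≤-trans (∑-member x∈) (m≤n+m _ (f y))

  # : {P : A → Set} → Decidable P → List A → ℕ
  # P? xs = length (filter P? xs)

  #-∑ : {P : A → Set} (P? : Decidable P) → ∀ xs → # P? xs ≡ ∑[ x ← xs ] ⟦ P? x ⟧
  #-∑ P? []       = refl
  #-∑ P? (x ∷ xs) with P? x
  ... | yes _ = cong suc (#-∑ P? xs)
  ... | no _  = #-∑ P? xs

  length-mono : ∀ {xs ys : List A} → Unique xs → (∀ {x} → x ∈ xs → x ∈ ys) → length xs ≤ length ys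
  length-mono {xs = []}     _        _  = z≤n
  length-mono {xs = x ∷ xs} {ys} (x∉ ∷ u) xs⊆ys
    with as , bs , refl ← ∈-∃++ (xs⊆ys (here refl)) =
    subst (suc (length xs) ≤_) (sym (len as)) (s≤s (length-mono u sub))
    where
    len : ∀ as → length (as ++ x ∷ bs) ≡ suc (length (as ++ bs))
    len []       = refl
    len (_ ∷ as) = cong suc (len as)
    sub : ∀ {y} → y ∈ xs → y ∈ as ++ bs
    sub y∈ with ∈-++⁻ as (xs⊆ys (there y∈))
    ... | inj₁ y∈as         = ∈-++⁺ˡ y∈as
    ... | inj₂ (here refl)  = contradiction refl (All.lookup x∉ y∈)
    ... | inj₂ (there y∈bs) = ∈-++⁺ʳ as y∈bs

  length-unique : ∀ {xs ys : List A} → Unique xs → Unique ys →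
                  (∀ {x} → x ∈ xs → x ∈ ys) → (∀ {x} → x ∈ ys → x ∈ xs) →
                  length xs ≡ length ys
  length-unique u v f g = ≤-antisym (length-mono u f) (length-mono v g)

  #-once : {P : A → Set} (P? : Decidable P) → ∀ {xs x} → Unique xs → x ∈ xs → P x →
           (∀ {y} → y ∈ xs → P y → y ≡ x) → # P? xs ≡ 1
  #-once P? {xs} u x∈ px only = length-unique (Unique.filter⁺ P? u) ([] ∷ [])
    (λ y∈ → let y∈xs , py = ∈-filter⁻ P? {xs = xs} y∈ in here (only y∈xs py))
    (λ { (here refl) → ∈-filter⁺ P? x∈ px })

  -- A missed `y` could be put in front of `xs`, giving a duplicate-free list inside `ys` that is
  -- longer than `ys`. It serves as a substitute for a dimension argument.
  exhausts : DecidableEquality A → ∀ {xs ys : List A} → Unique xs → (∀ {x} → x ∈ xs → x ∈ ys) →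
             length ys ≤ length xs → ∀ {y} → y ∈ ys → y ∈ xs
  exhausts _≟_ {xs} u xs⊆ys le {y} y∈ys with any? (y ≟_) xs
  ... | yes y∈xs = y∈xs
  ... | no  y∉xs = contradiction (≤-trans (length-mono (fresh ∷ u) sub) le) (<-irrefl refl)
    where
    fresh = All.tabulate λ x∈ eq → y∉xs (subst (_∈ xs) (sym eq) x∈)
    sub : ∀ {x} → x ∈ y ∷ xs → x ∈ _
    sub (here refl) = y∈ys
    sub (there x∈)  = xs⊆ys x∈

  inhabited : ∀ (xs : List A) → 1 ≤ length xs → ∃ (_∈ xs)
  inhabited (x ∷ _) _ = x , here refl

  -- Injectivity is asked only between members, because maps such as `pt` are shown to be injective
  -- only on `Σ∞`.
  unique-map : ∀ {f : A → C} {xs} → (∀ {x y} → x ∈ xs → y ∈ xs → f x ≡ f y → x ≡ y) →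
               Unique xs → Unique (map f xs)
  unique-map inj [] = []
  unique-map {f = f} {x ∷ xs} inj (x∉ ∷ u) =
    All.tabulate (λ y∈ eq → fresh y∈ eq) ∷ unique-map (λ p q → inj (there p) (there q)) u
    where
    fresh : ∀ {y} → y ∈ map f xs → f x ≢ y
    fresh y∈ refl with z , z∈ , eq ← ∈-map⁻ f y∈ =
      All.lookup x∉ z∈ (inj (here refl) (there z∈) eq)

  unique-cartesianProductWith : {D : Set} (f : A → C → D) {xs : List A} {ys : List C} →
    (∀ {a b c d} → a ∈ xs → b ∈ ys → c ∈ xs → d ∈ ys → f a b ≡ f c d → a ≡ c × b ≡ d) →
    Unique xs → Unique ys → Unique (cartesianProductWith f xs ys)
  unique-cartesianProductWith f inj []       v = []
  unique-cartesianProductWith f {x ∷ xs} {ys} inj (x∉ ∷ u) v = Unique.++⁺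
    (unique-map (λ b∈ d∈ eq → proj₂ (inj (here refl) b∈ (here refl) d∈ eq)) v)
    (unique-cartesianProductWith f (λ a∈ b∈ c∈ d∈ → inj (there a∈) b∈ (there c∈) d∈) u v)
    λ (w∈ , w∈′) →
      let b , b∈ , w≡ = ∈-map⁻ (f x) w∈
          c , d , c∈ , d∈ , w≡′ = ∈-cartesianProductWith⁻ f xs ys w∈′
      in All.lookup x∉ c∈ (proj₁ (inj (here refl) b∈ (there c∈) d∈ (trans (sym w≡) w≡′)))

  -- The binomial formula with the cross term moved to the left, so that no natural numbers are
  -- subtracted.
  ∣-∣²-identity : ∀ a c → ∣ a - c ∣ * ∣ a - c ∣ + 2 * (c * a) ≡ a * a + c * c
  ∣-∣²-identity zero c = trans (cong (λ t → c * c + 2 * t) (*-zeroʳ c)) (+-identityʳ (c * c))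
  ∣-∣²-identity (suc a) zero = refl
  ∣-∣²-identity (suc a) (suc c) = begin
    d + 2 * (suc c * suc a)             ≡⟨ l₁ d a c ⟩
    d + 2 * (c * a) + (2 * a + 2 * c + 2)     ≡⟨ cong (_+ (2 * a + 2 * c + 2)) (∣-∣²-identity a c) ⟩
    a * a + c * c + (2 * a + 2 * c + 2) ≡⟨ l₂ a c ⟩
    suc a * suc a + suc c * suc c       ∎
    where
    open ≡-Reasoning
    d = ∣ a - c ∣ * ∣ a - c ∣
    l₁ : ∀ d a c → d + 2 * (suc c * suc a) ≡ d + 2 * (c * a) + (2 * a + 2 * c + 2)
    l₁ = solve-∀
    l₂ : ∀ a c → a * a + c * c + (2 * a + 2 * c + 2) ≡ suc a * suc a + suc c * suc c
    l₂ = solve-∀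

  -- The extra summand on the left stands in for the subtraction in `length xs - # P? xs`, the
  -- number of entries with value `y`.
  ∑-if : {P : A → Set} (P? : Decidable P) → ∀ x y xs →
         ∑[ i ← xs ] (if does (P? i) then x else y) + # P? xs * y ≡ # P? xs * x + length xs * y
  ∑-if P? x y []       = refl
  ∑-if P? x y (i ∷ xs) with P? i
  ... | yes _ = trans (shift x (∑ xs _) y (# P? xs * y))
                  (trans (cong (λ t → x + y + t) (∑-if P? x y xs)) (unshift x y (# P? xs * x) (length xs * y)))
    where
    shift : ∀ x s y r → x + s + (y + r) ≡ x + y + (s + r)
    shift = solve-∀
    unshift : ∀ x y p l → x + y + (p + l) ≡ x + p + (y + l)
    unshift = solve-∀
  ... | no _  = trans (+-assoc y (∑ xs _) _)
                  (trans (cong (y +_) (∑-if P? x y xs)) (shift y (# P? xs * x) (length xs * y)))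
    where
    shift : ∀ y p l → y + (p + l) ≡ p + (y + l)
    shift = solve-∀

  length-allFin : ∀ n → length (allFin n) ≡ n
  length-allFin n = length-tabulate {n = n} id

  ∑-allFin-except : ∀ {s} (z : Fin s) x y →
                    ∑[ i ← allFin s ] (if does (i Fin.≟ z) then x else y) ≡ x + pred s * y
  ∑-allFin-except {s} z x y = +-cancelʳ-≡ (1 * y) _ _ (begin
    ∑ (allFin s) h + 1 * y                       ≡⟨ cong (λ t → ∑ (allFin s) h + t * y) once ⟨
    ∑ (allFin s) h + # (Fin._≟ z) (allFin s) * y ≡⟨ ∑-if (Fin._≟ z) x y (allFin s) ⟩
    # (Fin._≟ z) (allFin s) * x + length (allFin s) * y
      ≡⟨ cong₂ (λ t l → t * x + l * y) once (trans (length-allFin s) (sym (suc-pred s {{nonZeroIndex z}}))) ⟩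
    1 * x + suc (pred s) * y                     ≡⟨ arith x (pred s) y ⟩
    x + pred s * y + 1 * y                       ∎)
    where
    open ≡-Reasoning
    h : Fin s → ℕ
    h i = if does (i Fin.≟ z) then x else y
    once : # (Fin._≟ z) (allFin s) ≡ 1
    once = #-once (Fin._≟ z) (Unique.allFin⁺ s) (∈-allFin z) refl (λ _ eq → eq)
    arith : ∀ x s y → 1 * x + suc s * y ≡ x + s * y + 1 * y
    arith = solve-∀

  -- The equality case of the Bruen-Thas bound.

  -- The parallel classes of an affine plane of order n², given as equivalence
  -- relations R i whose classes are the lines, and a set U of n³ points having at each
  -- of its points a tangent outside the parallel class z.
  module BruenThas
    {A : Set} (_≟A_ : DecidableEquality A)
    (n : ℕ) (1<n : 1 < n)
    {size : ℕ} (z : Fin size)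
    (S U : List A) (S-size : length S ≡ (n * n) * (n * n))
    (U-unique : Unique U) (U-size : length U ≡ n * (n * n)) (U⊆S : ∀ {u} → u ∈ U → u ∈ S)
    (R : Fin size → A → A → Set) (R? : ∀ i u v → Dec (R i u v))
    (R-refl : ∀ {i u} → R i u u) (R-sym : ∀ {i u v} → R i u v → R i v u)
    (R-trans : ∀ {i u v w} → R i u v → R i v w → R i u w)
    (S-unique : Unique S)
    (class-size : ∀ i {u} → u ∈ S → # (R? i u) S ≡ n * n)
    (join-unique : ∀ {u v} → u ∈ S → v ∈ S → u ≢ v → # (λ i → R? i u v) (allFin size) ≡ 1)
    (tangent : ∀ {u} → u ∈ U → ∃ λ i → i ≢ z × (∀ {v} → v ∈ U → R i u v → v ≡ u))
    where

    Is : List (Fin size)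
    Is = allFin size

    -- The size of the intersection of `U` with the line of class `i` through `p`.
    a : Fin size → A → ℕ
    a i p = # (R? i p) U

    a-cong : ∀ {i p u} → R i p u → a i p ≡ a i u
    a-cong {i} {p} {u} r = begin
      a i p                    ≡⟨ #-∑ (R? i p) U ⟩
      ∑[ v ← U ] ⟦ R? i p v ⟧  ≡⟨ ∑-cong U (λ {v} _ → ⟦⟧-cong (R? i p v) (R? i u v) (R-trans (R-sym r)) (R-trans r)) ⟩
      ∑[ v ← U ] ⟦ R? i u v ⟧  ≡⟨ #-∑ (R? i u) U ⟨
      a i u                    ∎
      where open ≡-Reasoning

    -- Counts the flags (u , p) with u ∈ U on the line of class i through p.
    flags : ∀ i (h : ℕ → ℕ) → ∑[ p ← S ] (a i p * h (a i p)) ≡ (n * n) * ∑[ u ← U ] h (a i u)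
    flags i h = begin
      ∑[ p ← S ] (a i p * h (a i p))                     ≡⟨ ∑-cong S (λ {p} _ → expand p) ⟩
      ∑[ p ← S ] ∑[ u ← U ] (h (a i p) * ⟦ R? i p u ⟧)   ≡⟨ ∑-swap _ S U ⟩
      ∑[ u ← U ] ∑[ p ← S ] (h (a i p) * ⟦ R? i p u ⟧)   ≡⟨ ∑-cong U (λ {u} _ → ∑-cong S (λ {p} _ → transfer p u)) ⟩
      ∑[ u ← U ] ∑[ p ← S ] (h (a i u) * ⟦ R? i u p ⟧)   ≡⟨ ∑-cong U collect ⟩
      ∑[ u ← U ] ((n * n) * h (a i u))                   ≡⟨ ∑-*ˡ (n * n) U ⟩
      (n * n) * ∑[ u ← U ] h (a i u)                     ∎
      where
      open ≡-Reasoning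
      expand : ∀ p → a i p * h (a i p) ≡ ∑[ u ← U ] (h (a i p) * ⟦ R? i p u ⟧)
      expand p = begin
        a i p * h (a i p)                         ≡⟨ *-comm (a i p) _ ⟩
        h (a i p) * a i p                         ≡⟨ cong (h (a i p) *_) (#-∑ (R? i p) U) ⟩
        h (a i p) * ∑[ u ← U ] ⟦ R? i p u ⟧       ≡⟨ ∑-*ˡ (h (a i p)) U ⟨
        ∑[ u ← U ] (h (a i p) * ⟦ R? i p u ⟧)     ∎
      -- Either `p` and `u` are on the same line, where `a i` is constant, or both indicators
      -- vanish.
      transfer : ∀ p u → h (a i p) * ⟦ R? i p u ⟧ ≡ h (a i u) * ⟦ R? i u p ⟧
      transfer p u with R? i p u
      ... | yes r = cong₂ _*_ (cong h (a-cong r)) (sym (⟦⟧-yes (R? i u p) (R-sym r)))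
      ... | no ¬r = trans (*-zeroʳ (h (a i p)))
                      (sym (trans (cong (h (a i u) *_) (⟦⟧-no (R? i u p) (¬r ∘ R-sym))) (*-zeroʳ (h (a i u)))))
      collect : ∀ {u} → u ∈ U → ∑[ p ← S ] (h (a i u) * ⟦ R? i u p ⟧) ≡ (n * n) * h (a i u)
      collect {u} u∈U = begin
        ∑[ p ← S ] (h (a i u) * ⟦ R? i u p ⟧)     ≡⟨ ∑-*ˡ (h (a i u)) S ⟩
        h (a i u) * ∑[ p ← S ] ⟦ R? i u p ⟧       ≡⟨ cong (h (a i u) *_) (#-∑ (R? i u) S) ⟨
        h (a i u) * # (R? i u) S                  ≡⟨ cong (h (a i u) *_) (class-size i (U⊆S u∈U)) ⟩
        h (a i u) * (n * n)                       ≡⟨ *-comm (h (a i u)) (n * n) ⟩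
        (n * n) * h (a i u)                       ∎

    k : ℕ
    k = pred size

    size≡ : size ≡ suc k
    size≡ = sym (suc-pred size {{nonZeroIndex z}})

    -- Distinct points share one class, while a point is related to itself in all `suc k` of them.
    -- Writing the second case as an excess of `k` on the diagonal makes the sum over `v` split.
    join-count : ∀ {u v} → u ∈ S → v ∈ S → ∑[ i ← Is ] ⟦ R? i u v ⟧ ≡ 1 + k * ⟦ v ≟A u ⟧
    join-count {u} {v} u∈ v∈ with v ≟A u
    ... | yes refl = begin
      ∑[ i ← Is ] ⟦ R? i u u ⟧  ≡⟨ ∑-cong Is (λ {i} _ → ⟦⟧-yes (R? i u u) R-refl) ⟩
      ∑[ _ ← Is ] 1             ≡⟨ ∑-const 1 Is ⟩
      length Is * 1             ≡⟨ *-identityʳ (length Is) ⟩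
      length Is                 ≡⟨ length-allFin size ⟩
      size                      ≡⟨ size≡ ⟩
      1 + k                     ≡⟨ cong suc (*-identityʳ k) ⟨
      1 + k * 1                 ∎
      where open ≡-Reasoning
    ... | no v≢u = trans (sym (#-∑ (λ i → R? i u v) Is))
                     (trans (join-unique u∈ v∈ (v≢u ∘ sym)) (cong suc (sym (*-zeroʳ k))))

    -- The set `X` is left open for two uses: `S` yields the number of classes, and `U` yields the
    -- second moment of `a`.
    joins : ∀ {u} (X : List A) → Unique X → (∀ {v} → v ∈ X → v ∈ S) → u ∈ X →
            ∑[ i ← Is ] # (R? i u) X ≡ length X + k
    joins {u} X X-unique X⊆S u∈X = begin
      ∑[ i ← Is ] # (R? i u) X                    ≡⟨ ∑-cong Is (λ {i} _ → #-∑ (R? i u) X) ⟩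
      ∑[ i ← Is ] ∑[ v ← X ] ⟦ R? i u v ⟧         ≡⟨ ∑-swap _ Is X ⟩
      ∑[ v ← X ] ∑[ i ← Is ] ⟦ R? i u v ⟧         ≡⟨ ∑-cong X (λ v∈ → join-count (X⊆S u∈X) (X⊆S v∈)) ⟩
      ∑[ v ← X ] (1 + k * ⟦ v ≟A u ⟧)             ≡⟨ ∑-+ X ⟩
      ∑[ _ ← X ] 1 + ∑[ v ← X ] (k * ⟦ v ≟A u ⟧)  ≡⟨ cong₂ _+_ (∑-const 1 X) (∑-*ˡ k X) ⟩
      length X * 1 + k * ∑[ v ← X ] ⟦ v ≟A u ⟧    ≡⟨ cong₂ _+_ (*-identityʳ (length X)) (cong (k *_) (sym (#-∑ (_≟A u) X))) ⟩
      length X + k * # (_≟A u) X                  ≡⟨ cong (λ t → length X + k * t) once ⟩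
      length X + k * 1                            ≡⟨ cong (length X +_) (*-identityʳ k) ⟩
      length X + k                                ∎
      where
      open ≡-Reasoning
      once : # (_≟A u) X ≡ 1
      once = #-once (_≟A u) X-unique u∈X refl (λ _ eq → eq)

    n² : ℕ
    n² = n * n

    1<n² : 1 < n²
    1<n² = *-mono-≤ {1} {n} {2} {n} (<⇒≤ 1<n) 1<n

    U-inhabited : ∃ (_∈ U)
    U-inhabited = inhabited U (subst (1 ≤_) (sym U-size) (*-mono-≤ {1} {n} {1} {n²} (<⇒≤ 1<n) (<⇒≤ 1<n²)))

    -- Counts the pairs (i , v) with v on the line of class i through a fixed point u.
    k≡n² : k ≡ n²
    k≡n² = cancel n² 1<n² (begin
      n² + k * n²                   ≡⟨ cong (_* n²) size≡ ⟨
      size * n²                     ≡⟨ cong (_* n²) (length-allFin size) ⟨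
      length Is * n²                ≡⟨ ∑-const n² Is ⟨
      ∑[ _ ← Is ] n²                ≡⟨ ∑-cong Is (λ {i} _ → sym (class-size i u∈S)) ⟩
      ∑[ i ← Is ] # (R? i u) S      ≡⟨ joins S S-unique id u∈S ⟩
      length S + k                  ≡⟨ cong (_+ k) S-size ⟩
      n² * n² + k                   ∎)
      where
      open ≡-Reasoning
      u = proj₁ U-inhabited
      u∈S = U⊆S (proj₂ U-inhabited)
      -- The equation amounts to (k - M)(M - 1) = 0. Writing M as `suc (suc s)` makes the factor M -
      -- 1 the cancellable `suc s`.
      cancel : ∀ M → 1 < M → M + k * M ≡ M * M + k → k ≡ M
      cancel (suc (suc s)) _ eq = *-cancelʳ-≡ k (suc (suc s)) (suc s)
        (+-cancelˡ-≡ (suc (suc s) + k) _ _ (trans (l₁ k s) (trans eq (l₂ k s))))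
        where
        l₁ : ∀ k s → suc (suc s) + k + k * suc s ≡ suc (suc s) + k * suc (suc s)
        l₁ = solve-∀
        l₂ : ∀ k s → suc (suc s) * suc (suc s) + k ≡ suc (suc s) + k + suc (suc s) * suc s
        l₂ = solve-∀
      cancel (suc zero) (s≤s ()) _

    -- The number of points that a line of class i has to share with U unless it is a
    -- tangent; lines of class z also contain a point at infinity of the unital.
    c : Fin size → ℕ
    c i = if does (i Fin.≟ z) then n else suc n

    -- `f` is the squared deviation, and `g` keeps only the part that tangents outside class `z`
    -- must contribute: there `a` is 1 and `c` is `suc n`, so the deviation is n. The factor
    -- `a i p`, equal to 1 wherever the indicator is nonzero, gives `g` the shape that `flags` can
    -- sum.
    f g : Fin size → A → ℕ
    f i p = ∣ a i p - c i ∣ * ∣ a i p - c i ∣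
    g i p = (if does (i Fin.≟ z) then 0 else n²) * (a i p * ⟦ a i p ≟ 1 ⟧)

    ∑∑ : (Fin size → A → ℕ) → ℕ
    ∑∑ h = ∑[ i ← Is ] ∑[ p ← S ] h i p

    ∑-of-c : ∀ (h : ℕ → ℕ) → ∑[ i ← Is ] h (c i) ≡ h n + n² * h (suc n)
    ∑-of-c h = trans (∑-cong Is (λ {i} _ → push i)) (trans (∑-allFin-except z (h n) (h (suc n))) (cong (λ t → h n + t * h (suc n)) k≡n²))
      where
      push : ∀ i → h (c i) ≡ (if does (i Fin.≟ z) then h n else h (suc n))
      push i with i Fin.≟ z
      ... | yes _ = refl
      ... | no _  = refl

    ∑-a : ∀ i → ∑[ p ← S ] a i p ≡ n² * (n * n²)
    ∑-a i = begin
      ∑[ p ← S ] a i p          ≡⟨ ∑-cong S (λ {p} _ → *-identityʳ (a i p)) ⟨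
      ∑[ p ← S ] (a i p * 1)    ≡⟨ flags i (λ _ → 1) ⟩
      n² * ∑[ _ ← U ] 1         ≡⟨ cong (n² *_) (trans (∑-const 1 U) (trans (*-identityʳ (length U)) U-size)) ⟩
      n² * (n * n²)             ∎
      where open ≡-Reasoning

    -- By `flags` with `h = id` this reduces to the lines through a point of `U`: each of the n³ - 1
    -- other points is on one of them, and the point itself is on all n² + 1, giving n³ + n².
    ∑∑-a² : ∑∑ (λ i p → a i p * a i p) ≡ n² * (n * n² * (n * n² + n²))
    ∑∑-a² = begin
      ∑∑ (λ i p → a i p * a i p)                ≡⟨ ∑-cong Is (λ {i} _ → flags i id) ⟩
      ∑[ i ← Is ] (n² * ∑[ u ← U ] a i u)       ≡⟨ ∑-*ˡ n² Is ⟩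
      n² * ∑[ i ← Is ] ∑[ u ← U ] a i u         ≡⟨ cong (n² *_) (∑-swap a Is U) ⟩
      n² * ∑[ u ← U ] ∑[ i ← Is ] a i u         ≡⟨ cong (n² *_) (∑-cong U (joins U U-unique U⊆S)) ⟩
      n² * ∑[ _ ← U ] (length U + k)            ≡⟨ cong (n² *_) (∑-const _ U) ⟩
      n² * (length U * (length U + k))          ≡⟨ cong₂ (λ s t → n² * (s * (s + t))) U-size k≡n² ⟩
      n² * (n * n² * (n * n² + n²))             ∎
      where open ≡-Reasoning

    -- The expanded square needs three moments: that of `a²` from pairs of points, that of `c²` from
    -- the number of flags, and the mixed one, which factors because `∑-a` gives the same total for
    -- every class. The mixed term is carried on both sides and cancelled.
    ∑∑-f : ∑∑ f ≡ n² * (n² * (n * n²))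
    ∑∑-f = +-cancelʳ-≡ (∑∑ (λ i p → 2 * (c i * a i p))) _ _ (begin
      ∑∑ f + ∑∑ (λ i p → 2 * (c i * a i p))                        ≡⟨ ∑∑-+ f (λ i p → 2 * (c i * a i p)) ⟨
      ∑∑ (λ i p → f i p + 2 * (c i * a i p))                       ≡⟨ ∑-cong Is (λ {i} _ → ∑-cong S (λ {p} _ → ∣-∣²-identity (a i p) (c i))) ⟩
      ∑∑ (λ i p → a i p * a i p + c i * c i)                       ≡⟨ ∑∑-+ (λ i p → a i p * a i p) (λ i _ → c i * c i) ⟩
      ∑∑ (λ i p → a i p * a i p) + ∑∑ (λ i _ → c i * c i)          ≡⟨ cong₂ _+_ ∑∑-a² (∑-cong Is (λ {i} _ → ∑-const (c i * c i) S)) ⟩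
      n² * (n * n² * (n * n² + n²)) + ∑[ i ← Is ] (length S * (c i * c i)) ≡⟨ cong (n² * (n * n² * (n * n² + n²)) +_) ∑-c² ⟩
      n² * (n * n² * (n * n² + n²)) + n² * n² * (n * n + n² * (suc n * suc n)) ≡⟨ arith n ⟩
      n² * (n² * (n * n²)) + 2 * (n² * (n * n²)) * (n + n² * suc n) ≡⟨ cong (n² * (n² * (n * n²)) +_) ∑∑-ca ⟨
      n² * (n² * (n * n²)) + ∑∑ (λ i p → 2 * (c i * a i p))        ∎)
      where
      open ≡-Reasoning
      ∑∑-+ : ∀ h h′ → ∑∑ (λ i p → h i p + h′ i p) ≡ ∑∑ h + ∑∑ h′
      ∑∑-+ h h′ = trans (∑-cong Is (λ _ → ∑-+ S)) (∑-+ Is)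
      ∑-c² : ∑[ i ← Is ] (length S * (c i * c i)) ≡ n² * n² * (n * n + n² * (suc n * suc n))
      ∑-c² = trans (∑-*ˡ (length S) Is) (cong₂ _*_ S-size (∑-of-c (λ x → x * x)))
      ∑∑-ca : ∑∑ (λ i p → 2 * (c i * a i p)) ≡ 2 * (n² * (n * n²)) * (n + n² * suc n)
      ∑∑-ca = begin
        ∑∑ (λ i p → 2 * (c i * a i p))                  ≡⟨ ∑-cong Is (λ {i} _ → row i) ⟩
        ∑[ i ← Is ] (2 * (n² * (n * n²)) * c i)         ≡⟨ ∑-*ˡ (2 * (n² * (n * n²))) Is ⟩
        2 * (n² * (n * n²)) * ∑[ i ← Is ] c i           ≡⟨ cong (2 * (n² * (n * n²)) *_) (∑-of-c id) ⟩
        2 * (n² * (n * n²)) * (n + n² * suc n)          ∎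
        where
        swap-factors : ∀ c t → 2 * (c * t) ≡ 2 * t * c
        swap-factors = solve-∀
        row : ∀ i → ∑[ p ← S ] (2 * (c i * a i p)) ≡ 2 * (n² * (n * n²)) * c i
        row i = begin
          ∑[ p ← S ] (2 * (c i * a i p))     ≡⟨ ∑-*ˡ 2 S ⟩
          2 * ∑[ p ← S ] (c i * a i p)       ≡⟨ cong (2 *_) (∑-*ˡ (c i) S) ⟩
          2 * (c i * ∑[ p ← S ] a i p)       ≡⟨ cong (λ t → 2 * (c i * t)) (∑-a i) ⟩
          2 * (c i * (n² * (n * n²)))        ≡⟨ swap-factors (c i) (n² * (n * n²)) ⟩
          2 * (n² * (n * n²)) * c i          ∎
      arith : ∀ n → let n² = n * n in
              n² * (n * n² * (n * n² + n²)) + n² * n² * (n * n + n² * (suc n * suc n)) ≡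
              n² * (n² * (n * n²)) + 2 * (n² * (n * n²)) * (n + n² * suc n)
      arith = solve-∀

    tangent-count : ∀ {u} → u ∈ U →
      n² ≤ ∑[ i ← Is ] ((if does (i Fin.≟ z) then 0 else n²) * ⟦ a i u ≟ 1 ⟧)
    tangent-count {u} u∈ with i , i≢z , only-u ← tangent u∈ =
      ≤-trans (≤-reflexive (sym term)) (∑-member (∈-allFin i))
      where
      touches : a i u ≡ 1
      touches = #-once (R? i u) U-unique u∈ R-refl only-u
      term : (if does (i Fin.≟ z) then 0 else n²) * ⟦ a i u ≟ 1 ⟧ ≡ n²
      term with i Fin.≟ z
      ... | yes i≡z = contradiction i≡z i≢z
      ... | no _    = trans (cong (n² *_) (⟦⟧-yes (a i u ≟ 1) touches)) (*-identityʳ n²)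

    -- Each of the n³ points of `U` has a tangent outside class `z`, which is seen from its n²
    -- points with weight n². Only this lower bound is available, as a point might have several
    -- tangents.
    ∑∑-g : n² * (n² * (n * n²)) ≤ ∑∑ g
    ∑∑-g = begin
      n² * (n² * (n * n²))                                      ≡⟨ cong (λ t → n² * (n² * t)) U-size ⟨
      n² * (n² * length U)                                      ≡⟨ cong (n² *_) (trans (*-comm n² (length U)) (sym (∑-const n² U))) ⟩
      n² * ∑[ _ ← U ] n²                                        ≤⟨ *-monoʳ-≤ n² (∑-mono U tangent-count) ⟩
      n² * ∑[ u ← U ] ∑[ i ← Is ] (w i * ⟦ a i u ≟ 1 ⟧)         ≡⟨ cong (n² *_) (∑-swap (λ u i → w i * ⟦ a i u ≟ 1 ⟧) U Is) ⟩
      n² * ∑[ i ← Is ] ∑[ u ← U ] (w i * ⟦ a i u ≟ 1 ⟧)         ≡⟨ cong (n² *_) (∑-cong Is (λ {i} _ → ∑-*ˡ (w i) U)) ⟩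
      n² * ∑[ i ← Is ] (w i * ∑[ u ← U ] ⟦ a i u ≟ 1 ⟧)         ≡⟨ ∑-*ˡ n² Is ⟨
      ∑[ i ← Is ] (n² * (w i * ∑[ u ← U ] ⟦ a i u ≟ 1 ⟧))       ≡⟨ ∑-cong Is (λ {i} _ → row i) ⟩
      ∑∑ g                                                      ∎
      where
      open ≤-Reasoning
      w : Fin size → ℕ
      w i = if does (i Fin.≟ z) then 0 else n²
      swap-factors : ∀ x y t → x * (y * t) ≡ y * (x * t)
      swap-factors = solve-∀
      row : ∀ i → n² * (w i * ∑[ u ← U ] ⟦ a i u ≟ 1 ⟧) ≡ ∑[ p ← S ] g i p
      row i = trans (swap-factors n² (w i) _)
                (trans (cong (w i *_) (sym (flags i (λ t → ⟦ t ≟ 1 ⟧)))) (sym (∑-*ˡ (w i) S)))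

    not-tangent : ∀ x {t} → t ≢ 1 → x * (t * ⟦ t ≟ 1 ⟧) ≡ 0
    not-tangent x {t} t≢1 =
      trans (cong (λ y → x * (t * y)) (⟦⟧-no (t ≟ 1) t≢1)) (trans (cong (x *_) (*-zeroʳ t)) (*-zeroʳ x))

    g≤f : ∀ i p → g i p ≤ f i p
    g≤f i p with i Fin.≟ z
    ... | yes _ = z≤n
    ... | no _ with a i p ≟ 1
    ...   | no a≢1 = ≤-trans (≤-reflexive (not-tangent n² a≢1)) z≤n
    ...   | yes eq rewrite eq = ≤-reflexive (*-identityʳ n²)

    g≡f : ∀ i {p} → p ∈ S → g i p ≡ f i p
    g≡f i p∈ =
      -- Tightness is used twice: the inner application equates the totals of each class, the outer
      -- one the entries within class `i`.
      ∑-tight (λ {p} _ → g≤f i p)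
        (≤-reflexive (sym (∑-tight (λ {j} _ → ∑-mono S (λ {p} _ → g≤f j p))
                             (≤-trans (≤-reflexive ∑∑-f) ∑∑-g) (∈-allFin i)))) p∈

    -- Away from tangents `g` is 0, hence so is the squared deviation `f`.
    secant-or-tangent : ∀ {i} → i ≢ z → ∀ {p} → p ∈ S → a i p ≡ 1 ⊎ a i p ≡ suc n
    secant-or-tangent {i} i≢z {p} p∈ with g≡f i p∈
    ... | eq with i Fin.≟ z
    ...   | yes i≡z = contradiction i≡z i≢z
    ...   | no _ with a i p ≟ 1
    ...     | yes a≡1 = inj₁ a≡1
    ...     | no a≢1  = inj₂ (square≡0 (trans (sym eq) (not-tangent n² a≢1)))
      where
      square≡0 : ∣ a i p - suc n ∣ * ∣ a i p - suc n ∣ ≡ 0 → a i p ≡ suc n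
      square≡0 sq with m*n≡0⇒m≡0∨n≡0 ∣ a i p - suc n ∣ sq
      ... | inj₁ e = ∣m-n∣≡0⇒m≡n e
      ... | inj₂ e = ∣m-n∣≡0⇒m≡n e

    -- The weight of class `z` in `g` is 0, so the deviation from `n` vanishes on every line of this
    -- class.
    class-z-count : ∀ {p} → p ∈ S → a z p ≡ n
    class-z-count {p} p∈ with g≡f z p∈
    ... | eq with z Fin.≟ z
    ...   | no z≢z = contradiction refl z≢z
    ...   | yes _ with m*n≡0⇒m≡0∨n≡0 ∣ a z p - n ∣ (sym eq)
    ...     | inj₁ e = ∣m-n∣≡0⇒m≡n e
    ...     | inj₂ e = ∣m-n∣≡0⇒m≡n e

open Counting

length-cartesianProductWith : ∀ {A B C : Set} (f : A → B → C) xs ys →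
  length (cartesianProductWith f xs ys) ≡ length xs ℕ.* length ys
length-cartesianProductWith f []       ys = refl
length-cartesianProductWith f (x ∷ xs) ys =
  trans (length-++ (map (f x) ys)) (cong₂ ℕ._+_ (length-map (f x) ys) (length-cartesianProductWith f xs ys))

-- Subspaces and point sets are bare predicates; an enumeration is what makes membership decidable.
Card-Dec : ∀ {X : Set} → DecidableEquality X → ∀ {A : X → Set} {k} → Card A k → ∀ x → Dec (A x)
Card-Dec _≟_ (xs , _ , _ , xs⇔A) x = map′ (Equivalence.to (xs⇔A x)) (Equivalence.from (xs⇔A x)) (any? (x ≟_) xs)

-- Vector arithmetic over a finite field.

module Vectors (𝔽 : FiniteField) where
  open FiniteField 𝔽 renaming (Carrier to F)
  open IsCommutativeRing isCommutativeRing public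
    using (+-assoc; +-comm; +-identityˡ; +-identityʳ; -‿inverseˡ; -‿inverseʳ; *-assoc; *-comm;
           *-identityˡ; *-identityʳ; distribˡ; distribʳ; zeroˡ; zeroʳ)

  ring : CommutativeRing _ _
  ring = record { isCommutativeRing = isCommutativeRing }

  open Algebra.Properties.Ring (CommutativeRing.ring ring) public using (-1*x≈-x; x∙y⁻¹≈ε⇒x≈y)

  1≢0 : 1# ≢ 0#
  1≢0 = 0≢1 ∘ sym

  invertible : ∀ {c} → c ≢ 0# → ∃ λ d → d ≢ 0# × d * c ≡ 1#
  invertible {c} c≢0 with d , eq ← inverse c c≢0 =
    d , (λ { refl → 0≢1 (trans (sym (zeroʳ c)) eq) }) , trans (*-comm d c) eq

  1<order : 1 < order
  1<order = subst (2 ≤_) elements-length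
    (length-mono {xs = 0# ∷ 1# ∷ []} ((0≢1 ∷ []) ∷ [] ∷ []) (λ {x} _ → elements-complete x))

  infixl 6 _⊕_ _∸_
  infixr 7 _·_
  infix  8 ⊖_

  _⊕_ : ∀ {k} → Vec F k → Vec F k → Vec F k
  _⊕_ = zipWith _+_

  ⊖_ : ∀ {k} → Vec F k → Vec F k
  ⊖_ = mapᵛ (-_)

  _∸_ : ∀ {k} → Vec F k → Vec F k → Vec F k
  u ∸ v = u ⊕ ⊖ v

  _·_ : ∀ {k} → F → Vec F k → Vec F k
  c · v = mapᵛ (c *_) v

  0ᵛ : ∀ {k} → Vec F k
  0ᵛ = replicate _ 0#

  _≟ᵛ_ : ∀ {k} → DecidableEquality (Vec F k)
  _≟ᵛ_ = ≡-dec _≟_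

  vectorGroup : ℕ → AbelianGroup _ _
  vectorGroup k = record
    { Carrier = Vec F k ; _≈_ = _≡_ ; _∙_ = _⊕_ ; ε = 0ᵛ ; _⁻¹ = ⊖_
    ; isAbelianGroup = record
      { isGroup = record
        { isMonoid = record
          { isSemigroup = record
            { isMagma = record { isEquivalence = isEquivalence ; ∙-cong = cong₂ _⊕_ }
            ; assoc = zipWith-assoc +-assoc }
          ; identity = zipWith-identityˡ +-identityˡ , zipWith-identityʳ +-identityʳ }
        ; inverse = zipWith-inverseˡ -‿inverseˡ , zipWith-inverseʳ -‿inverseʳ
        ; ⁻¹-cong = cong ⊖_ }
      ; comm = zipWith-comm +-comm } }

  ·-⊕ : ∀ {k} c (u v : Vec F k) → c · (u ⊕ v) ≡ c · u ⊕ c · v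
  ·-⊕ c []      []      = refl
  ·-⊕ c (x ∷ u) (y ∷ v) = cong₂ _∷_ (distribˡ c x y) (·-⊕ c u v)

  +-· : ∀ {k} c d (v : Vec F k) → (c + d) · v ≡ c · v ⊕ d · v
  +-· c d []      = refl
  +-· c d (x ∷ v) = cong₂ _∷_ (distribʳ x c d) (+-· c d v)

  module _ {k : ℕ} where
    open Algebra.Properties.AbelianGroup (vectorGroup k) public
      using (xyx⁻¹≈y)
      renaming (⁻¹-∙-comm to ⊖-⊕; ⁻¹-anti-homo‿- to ⊖-∸; x∙y⁻¹≈ε⇒x≈y to ∸≡0⇒≡; x≈y⇒x∙y⁻¹≈ε to ≡⇒∸≡0;
                inverseˡ-unique to ⊕≡0⇒≡⊖; //-rightDividesˡ to ∸-⊕; ∙-cancelˡ to ⊕-cancelˡ)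
    open AbelianGroup (vectorGroup k) public using ()
      renaming (assoc to ⊕-assoc; comm to ⊕-comm; identityˡ to ⊕-identityˡ; identityʳ to ⊕-identityʳ; inverseʳ to ⊕-inverseʳ)

    ⊕-∸ : ∀ u v → u ⊕ (v ∸ u) ≡ v
    ⊕-∸ u v = trans (⊕-comm u (v ∸ u)) (∸-⊕ u v)

    ⊕-∸-cancel : ∀ u v → u ⊕ v ∸ u ≡ v
    ⊕-∸-cancel = xyx⁻¹≈y

    ∸-trans : ∀ u v w → (v ∸ u) ⊕ (w ∸ v) ≡ w ∸ u
    ∸-trans u v w = begin
      (v ∸ u) ⊕ (w ∸ v)   ≡⟨ ⊕-comm (v ∸ u) (w ∸ v) ⟩
      (w ∸ v) ⊕ (v ∸ u)   ≡⟨ ⊕-assoc (w ∸ v) v (⊖ u) ⟨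
      (w ∸ v) ⊕ v ∸ u     ≡⟨ cong (_∸ u) (∸-⊕ v w) ⟩
      w ∸ u               ∎
      where open ≡-Reasoning

    interchange : ∀ u v w x → (u ⊕ v) ⊕ (w ⊕ x) ≡ (u ⊕ w) ⊕ (v ⊕ x)
    interchange u v w x = begin
      (u ⊕ v) ⊕ (w ⊕ x)   ≡⟨ ⊕-assoc u v (w ⊕ x) ⟩
      u ⊕ (v ⊕ (w ⊕ x))   ≡⟨ cong (u ⊕_) (⊕-assoc v w x) ⟨
      u ⊕ (v ⊕ w ⊕ x)     ≡⟨ cong (λ t → u ⊕ (t ⊕ x)) (⊕-comm v w) ⟩
      u ⊕ (w ⊕ v ⊕ x)     ≡⟨ cong (u ⊕_) (⊕-assoc w v x) ⟩
      u ⊕ (w ⊕ (v ⊕ x))   ≡⟨ ⊕-assoc u w (v ⊕ x) ⟨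
      (u ⊕ w) ⊕ (v ⊕ x)   ∎
      where open ≡-Reasoning

    ⊕-∸-⊕ : ∀ u v w x → (u ⊕ v) ∸ (w ⊕ x) ≡ (u ∸ w) ⊕ (v ∸ x)
    ⊕-∸-⊕ u v w x = trans (cong ((u ⊕ v) ⊕_) (sym (⊖-⊕ w x))) (interchange u v (⊖ w) (⊖ x))

    difference : ∀ u v w x → u ⊕ v ≡ w ⊕ x → u ∸ w ≡ x ∸ v
    difference u v w x eq =
      trans (⊕≡0⇒≡⊖ (u ∸ w) (v ∸ x) (trans (sym (⊕-∸-⊕ u v w x)) (≡⇒∸≡0 eq))) (⊖-∸ v x)

    *-· : ∀ c d (v : Vec F k) → (c * d) · v ≡ c · d · v
    *-· c d v = trans (map-cong (*-assoc c d) v) (map-∘ (c *_) (d *_) v)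

    1-· : ∀ (v : Vec F k) → 1# · v ≡ v
    1-· v = trans (map-cong *-identityˡ v) (map-id v)

    0-· : ∀ (v : Vec F k) → 0# · v ≡ 0ᵛ
    0-· v = trans (map-cong zeroˡ v) (map-const v 0#)

    ·-0 : ∀ c → c · 0ᵛ {k} ≡ 0ᵛ
    ·-0 c = trans (map-replicate (c *_) 0# k) (cong (replicate k) (zeroʳ c))

    -1-· : ∀ (v : Vec F k) → (- 1#) · v ≡ ⊖ v
    -1-· v = map-cong -1*x≈-x v

    ·-cancel : ∀ {c d} {v w : Vec F k} → d * c ≡ 1# → v ≡ c · w → w ≡ d · v
    ·-cancel {c} {d} {w = w} dc≡1 refl = begin
      w            ≡⟨ 1-· w ⟨
      1# · w       ≡⟨ cong (_· w) dc≡1 ⟨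
      (d * c) · w  ≡⟨ *-· d c w ⟩
      d · c · w    ∎
      where open ≡-Reasoning

  -- Together with the cardinality, these closure properties are all that is extracted from a basis
  -- given by `VDim`.
  record IsSubspace {k} (A : Vec F k → Set) : Set where
    field
      0-closed : A 0ᵛ
      ⊕-closed : ∀ {u v} → A u → A v → A (u ⊕ v)
      ·-closed : ∀ c {v} → A v → A (c · v)

    ⊖-closed : ∀ {v} → A v → A (⊖ v)
    ⊖-closed Av = subst A (-1-· _) (·-closed (- 1#) Av)

    ∸-closed : ∀ {u v} → A u → A v → A (u ∸ v)
    ∸-closed Au Av = ⊕-closed Au (⊖-closed Av)

    ·-reflects : ∀ {c v} → c ≢ 0# → A (c · v) → A v
    ·-reflects {c} c≢0 Acv with d , _ , dc≡1 ← invertible c≢0 =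
      subst A (sym (·-cancel dc≡1 refl)) (·-closed d Acv)

    ⊕-reflectsʳ : ∀ {u v} → A u → A (u ⊕ v) → A v
    ⊕-reflectsʳ Au Auv = subst A (⊕-∸-cancel _ _) (∸-closed Auv Au)

    ⊕-reflectsˡ : ∀ {u v} → A v → A (u ⊕ v) → A u
    ⊕-reflectsˡ Av Auv = ⊕-reflectsʳ Av (subst A (⊕-comm _ _) Auv)

  allVec : ∀ k → List (Vec F k)
  allVec zero    = [] ∷ []
  allVec (suc k) = cartesianProductWith _∷_ elements (allVec k)

  allVec-unique : ∀ k → Unique (allVec k)
  allVec-unique zero    = [] ∷ []
  allVec-unique (suc k) = Unique.cartesianProductWith⁺ _∷_ ∷-injective elements-unique (allVec-unique k)

  allVec-complete : ∀ {k} (v : Vec F k) → v ∈ allVec k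
  allVec-complete []      = here refl
  allVec-complete (x ∷ v) = ∈-cartesianProductWith⁺ _∷_ (elements-complete x) (allVec-complete v)

  length-allVec : ∀ k → length (allVec k) ≡ order ℕ.^ k
  length-allVec zero    = refl
  length-allVec (suc k) = trans (length-cartesianProductWith _∷_ elements (allVec k))
                            (cong₂ ℕ._*_ elements-length (length-allVec k))

-- Cardinality of subspaces and normalised representatives of points.

module Subspaces (𝔽 : FiniteField) (N : ℕ) where
  open FiniteField 𝔽 renaming (Carrier to F)
  open Geometry 𝔽 N
  open Vectors 𝔽

  lc-cong : ∀ {k} {c d : Fin k → F} (vs : Fin k → V) → (∀ j → c j ≡ d j) → lc c vs ≡ lc d vs
  lc-cong {zero}  vs eq = refl
  lc-cong {suc k} vs eq = cong₂ _⊕_ (cong (_· vs zero) (eq zero)) (lc-cong (vs ∘ suc) (eq ∘ suc))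

  lc-⊕ : ∀ {k} (c d : Fin k → F) (vs : Fin k → V) → lc (λ j → c j + d j) vs ≡ lc c vs ⊕ lc d vs
  lc-⊕ {zero}  c d vs = sym (⊕-identityˡ 0ᵛ)
  lc-⊕ {suc k} c d vs =
    trans (cong₂ _⊕_ (+-· (c zero) (d zero) (vs zero)) (lc-⊕ (c ∘ suc) (d ∘ suc) (vs ∘ suc)))
      (interchange (c zero · vs zero) (d zero · vs zero) (lc (c ∘ suc) (vs ∘ suc)) (lc (d ∘ suc) (vs ∘ suc)))

  lc-· : ∀ {k} a (c : Fin k → F) (vs : Fin k → V) → lc (λ j → a * c j) vs ≡ a · lc c vs
  lc-· {zero}  a c vs = sym (·-0 a)
  lc-· {suc k} a c vs =
    trans (cong₂ _⊕_ (*-· a (c zero) (vs zero)) (lc-· a (c ∘ suc) (vs ∘ suc)))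
      (sym (·-⊕ a (c zero · vs zero) (lc (c ∘ suc) (vs ∘ suc))))

  module _ {k : ℕ} {A : VSet} (A-dim : VDim k A) where

    private
      vs : Fin k → V
      vs = proj₁ A-dim

      independent : Independent vs
      independent = proj₁ (proj₂ A-dim)

      A⇔span : ∀ v → A v ⇔ (∃ λ c → v ≡ lc c vs)
      A⇔span = proj₂ (proj₂ A-dim)

    VDim⇒IsSubspace : IsSubspace A
    VDim⇒IsSubspace = record
      { 0-closed = subst A (0-· (lc (λ _ → 0#) vs)) (closed· 0# (from (_ , refl)))
      ; ⊕-closed = λ Au Av → let c , u≡ = to Au ; d , v≡ = to Av in
                     from (_ , trans (cong₂ _⊕_ u≡ v≡) (sym (lc-⊕ c d vs)))
      ; ·-closed = closed· }
      where
      to : ∀ {v} → A v → ∃ λ c → v ≡ lc c vs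
      to {v} = Equivalence.to (A⇔span v)
      from : ∀ {v} → (∃ λ c → v ≡ lc c vs) → A v
      from {v} = Equivalence.from (A⇔span v)
      closed· : ∀ a {v} → A v → A (a · v)
      closed· a Av = let c , v≡ = to Av in from (_ , trans (cong (a ·_) v≡) (sym (lc-· a c vs)))

    lc-injective : ∀ {c d : Vec F k} → lc (lookup c) vs ≡ lc (lookup d) vs → c ≡ d
    lc-injective {c} {d} eq = begin
      c                    ≡⟨ tabulate∘lookup c ⟨
      tabulate (lookup c)  ≡⟨ tabulate-cong same ⟩
      tabulate (lookup d)  ≡⟨ tabulate∘lookup d ⟩
      d                    ∎
      where
      open ≡-Reasoning
      vanishes : lc (λ j → lookup c j + (- 1#) * lookup d j) vs ≡ zeroV
      vanishes = begin
        lc (λ j → lookup c j + (- 1#) * lookup d j) vs              ≡⟨ lc-⊕ (lookup c) _ vs ⟩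
        lc (lookup c) vs ⊕ lc (λ j → (- 1#) * lookup d j) vs        ≡⟨ cong (lc (lookup c) vs ⊕_) (lc-· (- 1#) (lookup d) vs) ⟩
        lc (lookup c) vs ⊕ (- 1#) · lc (lookup d) vs                ≡⟨ cong₂ _⊕_ eq (-1-· _) ⟩
        lc (lookup d) vs ∸ lc (lookup d) vs                         ≡⟨ ⊕-inverseʳ _ ⟩
        zeroV                                                       ∎
      same : ∀ j → lookup c j ≡ lookup d j
      same j = x∙y⁻¹≈ε⇒x≈y _ _ (trans (cong (lookup c j +_) (sym (-1*x≈-x _))) (independent _ vanishes j))

    -- The coefficient functions of `lc` are traded for coefficient vectors, which can be listed and
    -- compared.
    VDim⇒Card : Card A (order ℕ.^ k)
    VDim⇒Card = map vector (allVec k)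
              , unique-map (λ _ _ → lc-injective) (allVec-unique k)
              , trans (length-map vector (allVec k)) (length-allVec k)
              , λ v → mk⇔ (to v) (from v)
      where
      vector : Vec F k → V
      vector c = lc (lookup c) vs
      to : ∀ v → v ∈ map vector (allVec k) → A v
      to v v∈ with c , _ , v≡ ← ∈-map⁻ vector v∈ = Equivalence.from (A⇔span v) (lookup c , v≡)
      from : ∀ v → A v → v ∈ map vector (allVec k)
      from v Av with c , refl ← Equivalence.to (A⇔span v) Av =
        subst (_∈ map vector (allVec k)) (lc-cong vs (lookup∘tabulate c)) (∈-map⁺ vector (allVec-complete (tabulate c)))

  normalise : ∀ {k} (v : Vec F k) → v ≢ 0ᵛ → ∃ λ w → T (isNorm w) × ∃ λ c → c ≢ 0# × v ≡ c · w
  normalise []      v≢0 = contradiction refl v≢0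
  normalise (x ∷ v) v≢0 with x ≟ 0#
  ... | yes refl with w , w-norm , c , c≢0 , v≡ ← normalise v (v≢0 ∘ cong (0# ∷_)) =
    0# ∷ w , norm , c , c≢0 , cong₂ _∷_ (sym (zeroʳ c)) v≡
    where
    norm : T (isNorm (0# ∷ w))
    norm with 0# ≟ 0#
    ... | yes _  = w-norm
    ... | no 0≢0 = contradiction refl 0≢0
  ... | no x≢0 with y , _ , yx≡1 ← invertible x≢0 =
    1# ∷ y · v , norm , x , x≢0 , cong₂ _∷_ (sym (*-identityʳ x)) (·-cancel (trans (*-comm x y) yx≡1) refl)
    where
    norm : T (isNorm (1# ∷ y · v))
    norm with 1# ≟ 0#
    ... | yes 1≡0 = contradiction 1≡0 1≢0
    ... | no _ with 1# ≟ 1#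
    ...   | yes _  = _
    ...   | no 1≢1 = contradiction refl 1≢1

  -- The leading entries, both 1, must stand at the same place, which forces c = 1. The factor need
  -- not be assumed nonzero: c = 0 would make `v` zero, and the zero vector is not normalised.
  normalised-unique : ∀ {k} (v w : Vec F k) {c} → T (isNorm v) → T (isNorm w) → v ≡ c · w → v ≡ w
  normalised-unique (x ∷ v) (y ∷ w) {c} nv nw eq with x ≟ 0# | y ≟ 0#
  ... | yes refl | yes refl = cong (0# ∷_) (normalised-unique v w nv nw (∷-injectiveʳ eq))
  ... | no x≢0   | yes refl = contradiction (trans (∷-injectiveˡ eq) (zeroʳ c)) x≢0
  ... | yes refl | no y≢0 with y ≟ 1#
  ...   | yes refl = contradiction nv (vanishing v (trans (∷-injectiveʳ eq) (trans (cong (_· w) c≡0) (0-· w))))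
    where
    c≡0 : c ≡ 0#
    c≡0 = trans (sym (*-identityʳ c)) (sym (∷-injectiveˡ eq))
    vanishing : ∀ {k} (v : Vec F k) → v ≡ 0ᵛ → ¬ T (isNorm v)
    vanishing (x ∷ v) v≡0 nv with x ≟ 0#
    ... | yes _  = vanishing v (∷-injectiveʳ v≡0) nv
    ... | no x≢0 = x≢0 (∷-injectiveˡ v≡0)
  normalised-unique (x ∷ v) (y ∷ w) {c} nv nw eq | no x≢0 | no y≢0 with x ≟ 1# | y ≟ 1#
  ... | yes refl | yes refl = trans eq (trans (cong (_· (1# ∷ w)) c≡1) (1-· (1# ∷ w)))
    where
    c≡1 : c ≡ 1#
    c≡1 = trans (sym (*-identityʳ c)) (sym (∷-injectiveˡ eq))

  vec-injective : ∀ {P Q : Point} → vec P ≡ vec Q → P ≡ Q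
  vec-injective {P , p} {.P , q} refl = cong (P ,_) (T-irrelevant p q)

  proportional⇒≡ : ∀ {P Q : Point} {c d} → c ≢ 0# → c · vec P ≡ d · vec Q → P ≡ Q
  proportional⇒≡ {P} {Q} {c} {d} c≢0 eq with c′ , _ , c′c≡1 ← invertible c≢0 =
    vec-injective (normalised-unique (vec P) (vec Q) (proj₂ P) (proj₂ Q)
      (trans (·-cancel c′c≡1 refl) (trans (cong (c′ ·_) eq) (sym (*-· c′ d (vec Q))))))

  point-of : ∀ v → v ≢ zeroV → ∃ λ (P : Point) → ∃ λ c → c ≢ 0# × v ≡ c · vec P
  point-of v v≢0 with w , norm , c , c≢0 , v≡ ← normalise v v≢0 = (w , norm) , c , c≢0 , v≡

-- Affine coordinates.

-- The affine points off the hyperplane Σ∞ correspond to the vectors of Σ∞: s ∈ Σ∞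
-- represents the point spanned by e ⊕ s, for a fixed e ∉ Σ∞.
module AffineCoordinates (𝔽 : FiniteField) (h : ℕ) where
  open FiniteField 𝔽 renaming (Carrier to F)
  open Geometry 𝔽 (suc h)
  open Vectors 𝔽
  open Subspaces 𝔽 (suc h)

  module Coordinates (Σ∞ : VSet) (Σ∞-dim : VDim h Σ∞) (P₀ : Point) (P₀∉ : ¬ Σ∞ (vec P₀)) where

    e : V
    e = vec P₀

    Σ∞-subspace : IsSubspace Σ∞
    Σ∞-subspace = VDim⇒IsSubspace Σ∞-dim

    open IsSubspace Σ∞-subspace

    S : List V
    S = proj₁ (VDim⇒Card Σ∞-dim)

    S-unique : Unique S
    S-unique = proj₁ (proj₂ (VDim⇒Card Σ∞-dim))

    length-S : length S ≡ order ℕ.^ h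
    length-S = proj₁ (proj₂ (proj₂ (VDim⇒Card Σ∞-dim)))

    ∈S⇒Σ∞ : ∀ {s} → s ∈ S → Σ∞ s
    ∈S⇒Σ∞ {s} = Equivalence.to (proj₂ (proj₂ (proj₂ (VDim⇒Card Σ∞-dim))) s)

    Σ∞⇒∈S : ∀ {s} → Σ∞ s → s ∈ S
    Σ∞⇒∈S {s} = Equivalence.from (proj₂ (proj₂ (proj₂ (VDim⇒Card Σ∞-dim))) s)

    coordinates-unique : ∀ {s t c d} → Σ∞ s → Σ∞ t → s ⊕ c · e ≡ t ⊕ d · e → s ≡ t × c ≡ d
    coordinates-unique {s} {t} {c} {d} Σs Σt eq with c ≟ d
    ... | yes refl = trans (sym (⊕-∸-cancel (c · e) s))
                       (trans (cong (_∸ c · e) (trans (⊕-comm (c · e) s) (trans eq (⊕-comm t (c · e)))))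
                         (⊕-∸-cancel (c · e) t)) , refl
    ... | no c≢d = contradiction (·-reflects d-c≢0 (subst Σ∞ s∸t (∸-closed Σs Σt))) P₀∉
      where
      s∸t : s ∸ t ≡ (d + - c) · e
      s∸t = trans (difference s (c · e) t (d · e) eq)
              (trans (cong (d · e ⊕_) (trans (sym (-1-· (c · e))) (trans (sym (*-· (- 1#) c e)) (cong (_· e) (-1*x≈-x c)))))
                (sym (+-· d (- c) e)))
      d-c≢0 : d + - c ≢ 0#
      d-c≢0 eq = c≢d (sym (x∙y⁻¹≈ε⇒x≈y d c eq))

    -- Counting replaces a basis extension: the sums `s ⊕ c · e` are pairwise distinct, and there
    -- are as many of them as vectors in the whole space.
    coordinates : ∀ v → ∃ λ s → ∃ λ c → Σ∞ s × v ≡ s ⊕ c · e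
    coordinates v = let (s , c) , sc∈ , v≡ = ∈-map⁻ combine v∈ in s , c , Σ∞-of sc∈ , v≡
      where
      combine : V × F → V
      combine (s , c) = s ⊕ c · e
      pairs : List (V × F)
      pairs = cartesianProduct S elements
      Σ∞-of : ∀ {s c} → (s , c) ∈ pairs → Σ∞ s
      Σ∞-of sc∈ = ∈S⇒Σ∞ (proj₁ (∈-cartesianProduct⁻ S elements sc∈))
      injective : ∀ {x y} → x ∈ pairs → y ∈ pairs → combine x ≡ combine y → x ≡ y
      injective x∈ y∈ eq with refl , refl ← coordinates-unique (Σ∞-of x∈) (Σ∞-of y∈) eq = refl
      size : length (map combine pairs) ≡ length (allVec (suc h))
      size = begin
        length (map combine pairs)    ≡⟨ length-map combine pairs ⟩
        length pairs                  ≡⟨ length-cartesianProductWith _,_ S elements ⟩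
        length S ℕ.* length elements  ≡⟨ cong₂ ℕ._*_ length-S elements-length ⟩
        order ℕ.^ h ℕ.* order         ≡⟨ ℕ.*-comm (order ℕ.^ h) order ⟩
        order ℕ.^ suc h               ≡⟨ length-allVec (suc h) ⟨
        length (allVec (suc h))       ∎
        where open ≡-Reasoning
      v∈ : v ∈ map combine pairs
      v∈ = exhausts _≟ᵛ_ (unique-map injective (Unique.cartesianProduct⁺ S-unique elements-unique))
             (λ _ → allVec-complete _) (ℕ.≤-reflexive (sym size)) (allVec-complete v)

    affine-coordinates : ∀ {v} → ¬ Σ∞ v → ∃ λ s → ∃ λ c → Σ∞ s × c ≢ 0# × c · v ≡ e ⊕ s
    affine-coordinates {v} v∉ with s , c , Σs , refl ← coordinates v with c ≟ 0#
    ... | yes refl = contradiction (⊕-closed Σs (subst Σ∞ (sym (0-· e)) 0-closed)) v∉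
    ... | no c≢0 with d , d≢0 , dc≡1 ← invertible c≢0 =
      d · s , d , ·-closed d Σs , d≢0 , (begin
        d · (s ⊕ c · e)      ≡⟨ ·-⊕ d s (c · e) ⟩
        d · s ⊕ d · c · e    ≡⟨ cong (d · s ⊕_) (·-cancel dc≡1 refl) ⟨
        d · s ⊕ e            ≡⟨ ⊕-comm (d · s) e ⟩
        e ⊕ d · s            ∎)
      where open ≡-Reasoning

    -- Junk value P₀ outside the range of use: e ⊕ s ≢ 0 whenever s ∈ Σ∞.
    pt : V → Point
    pt s with (e ⊕ s) ≟ᵛ zeroV
    ... | yes _   = P₀
    ... | no e+s≢0 = proj₁ (point-of (e ⊕ s) e+s≢0)

    pt-spans : ∀ {s} → Σ∞ s → ∃ λ c → c ≢ 0# × e ⊕ s ≡ c · vec (pt s)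
    pt-spans {s} Σs with (e ⊕ s) ≟ᵛ zeroV
    ... | yes e+s≡0 = contradiction (⊕-reflectsˡ Σs (subst Σ∞ (sym e+s≡0) 0-closed)) P₀∉
    ... | no e+s≢0  = proj₂ (point-of (e ⊕ s) e+s≢0)

    pt-surjective : ∀ {Q} → ¬ Σ∞ (vec Q) → ∃ λ s → Σ∞ s × pt s ≡ Q
    pt-surjective {Q} Q∉ with s , c , Σs , c≢0 , eq ← affine-coordinates Q∉
                         with d , d≢0 , e+s≡ ← pt-spans Σs =
      s , Σs , sym (proportional⇒≡ c≢0 (trans eq e+s≡))

    e⊕ : ∀ s → e ⊕ s ≡ s ⊕ 1# · e
    e⊕ s = trans (⊕-comm e s) (cong (s ⊕_) (sym (1-· e)))

    affine-unique : ∀ {s t a} → Σ∞ s → Σ∞ t → e ⊕ s ≡ a · e ⊕ t → a ≡ 1# × s ≡ t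
    affine-unique {s} {t} {a} Σs Σt eq
      with s≡t , 1≡a ← coordinates-unique Σs Σt (trans (sym (e⊕ s)) (trans eq (⊕-comm (a · e) t))) =
      sym 1≡a , s≡t

    pt-injective : ∀ {s t} → Σ∞ s → Σ∞ t → pt s ≡ pt t → s ≡ t
    pt-injective {s} {t} Σs Σt eq
      with c , c≢0 , s≡ ← pt-spans Σs
         | d , d≢0 , t≡ ← pt-spans Σt
      with d′ , _ , d′d≡1 ← invertible d≢0 = trans (proj₂ unique) (trans (cong (_· t) (proj₁ unique)) (1-· t))
      where
      unique : c * d′ ≡ 1# × s ≡ (c * d′) · t
      unique = affine-unique Σs (·-closed (c * d′) Σt) (begin
        e ⊕ s                              ≡⟨ s≡ ⟩
        c · vec (pt s)                     ≡⟨ cong (λ P → c · vec P) eq ⟩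
        c · vec (pt t)                     ≡⟨ cong (c ·_) (·-cancel d′d≡1 t≡) ⟩
        c · d′ · (e ⊕ t)                   ≡⟨ *-· c d′ (e ⊕ t) ⟨
        (c * d′) · (e ⊕ t)                 ≡⟨ ·-⊕ (c * d′) e t ⟩
        (c * d′) · e ⊕ (c * d′) · t        ∎)
        where open ≡-Reasoning

    -- With the converse `pt-⊕⁻`, this identifies the affine points of the cone ⟨𝒱, P⟩ with a coset
    -- of 𝒱. The scalars arise from normalising representatives.
    pt-⊕ : ∀ {v g} → Σ∞ v → Σ∞ g → ∃ λ b → ∃ λ c → vec (pt (v ⊕ g)) ≡ b · v ⊕ c · vec (pt g)
    pt-⊕ {v} {g} Σv Σg
      with b , b≢0 , s≡ ← pt-spans (⊕-closed Σv Σg) | c , _ , g≡ ← pt-spans Σg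
      with b′ , _ , b′b≡1 ← invertible b≢0 = b′ , b′ * c , (begin
        vec (pt (v ⊕ g))                        ≡⟨ ·-cancel b′b≡1 s≡ ⟩
        b′ · (e ⊕ (v ⊕ g))                      ≡⟨ cong (b′ ·_) (⊕-assoc e v g) ⟨
        b′ · (e ⊕ v ⊕ g)                        ≡⟨ cong (λ t → b′ · (t ⊕ g)) (⊕-comm e v) ⟩
        b′ · (v ⊕ e ⊕ g)                        ≡⟨ cong (b′ ·_) (⊕-assoc v e g) ⟩
        b′ · (v ⊕ (e ⊕ g))                      ≡⟨ cong (λ t → b′ · (v ⊕ t)) g≡ ⟩
        b′ · (v ⊕ c · vec (pt g))               ≡⟨ ·-⊕ b′ v (c · vec (pt g)) ⟩
        b′ · v ⊕ b′ · c · vec (pt g)            ≡⟨ cong (b′ · v ⊕_) (*-· b′ c (vec (pt g))) ⟨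
        b′ · v ⊕ (b′ * c) · vec (pt g)          ∎)
      where open ≡-Reasoning

    pt-⊕⁻ : ∀ {s v g d} → Σ∞ s → Σ∞ v → Σ∞ g → vec (pt s) ≡ v ⊕ d · vec (pt g) → ∃ λ b → s ≡ b · v ⊕ g
    pt-⊕⁻ {s} {v} {g} {d} Σs Σv Σg pt-s≡
      with b , b≢0 , s≡ ← pt-spans Σs | c , c≢0 , g≡ ← pt-spans Σg
      with c′ , _ , c′c≡1 ← invertible c≢0 =
      b , trans (proj₂ unique) (cong (b · v ⊕_) (trans (cong (_· g) (proj₁ unique)) (1-· g)))
      where
      open ≡-Reasoning
      a : F
      -- The coefficient of `e` once everything is expanded; comparison with `e ⊕ s` makes it 1.
      a = b * d * c′
      e+s≡ : e ⊕ s ≡ a · e ⊕ (b · v ⊕ a · g)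
      e+s≡ = begin
        e ⊕ s                                  ≡⟨ s≡ ⟩
        b · vec (pt s)                         ≡⟨ cong (b ·_) pt-s≡ ⟩
        b · (v ⊕ d · vec (pt g))               ≡⟨ ·-⊕ b v (d · vec (pt g)) ⟩
        b · v ⊕ b · d · vec (pt g)             ≡⟨ cong (b · v ⊕_) (*-· b d (vec (pt g))) ⟨
        b · v ⊕ (b * d) · vec (pt g)           ≡⟨ cong (λ t → b · v ⊕ (b * d) · t) (·-cancel c′c≡1 g≡) ⟩
        b · v ⊕ (b * d) · c′ · (e ⊕ g)         ≡⟨ cong (b · v ⊕_) (*-· (b * d) c′ (e ⊕ g)) ⟨
        b · v ⊕ a · (e ⊕ g)                    ≡⟨ cong (b · v ⊕_) (·-⊕ a e g) ⟩
        b · v ⊕ (a · e ⊕ a · g)                ≡⟨ ⊕-assoc (b · v) (a · e) (a · g) ⟨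
        b · v ⊕ a · e ⊕ a · g                  ≡⟨ cong (_⊕ a · g) (⊕-comm (b · v) (a · e)) ⟩
        a · e ⊕ b · v ⊕ a · g                  ≡⟨ ⊕-assoc (a · e) (b · v) (a · g) ⟩
        a · e ⊕ (b · v ⊕ a · g)                ∎
      unique : a ≡ 1# × s ≡ b · v ⊕ a · g
      unique = affine-unique Σs (⊕-closed (·-closed b Σv) (·-closed a Σg)) e+s≡

    module _ {W : VSet} (W-subspace : IsSubspace W) where

      ∋pt⇒∋⊕ : ∀ {s} → Σ∞ s → W (vec (pt s)) → W (e ⊕ s)
      ∋pt⇒∋⊕ Σs W∋ with c , _ , eq ← pt-spans Σs = subst W (sym eq) (IsSubspace.·-closed W-subspace c W∋)

      ∋⊕⇒∋pt : ∀ {s} → Σ∞ s → W (e ⊕ s) → W (vec (pt s))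
      ∋⊕⇒∋pt Σs W∋ with c , c≢0 , eq ← pt-spans Σs = IsSubspace.·-reflects W-subspace c≢0 (subst W eq W∋)

    pt-affine : ∀ {s} → Σ∞ s → ¬ Σ∞ (vec (pt s))
    pt-affine Σs Σpt = P₀∉ (⊕-reflectsˡ Σs (∋pt⇒∋⊕ Σ∞-subspace Σs Σpt))

    -- In coordinates, the affine part of `W` is the coset of `E` through `base`.
    module AffineTrace {k} {W E : VSet} (W-dim : VDim k W) (W⊈Σ∞ : ¬ (W ⊆ Σ∞))
      (W∩Σ∞ : ∀ v → (W v × Σ∞ v) ⇔ E v) where

      private
        W-subspace : IsSubspace W
        W-subspace = VDim⇒IsSubspace W-dim

        module W = IsSubspace W-subspace

        Σ∞? : Decidable Σ∞
        Σ∞? = Card-Dec _≟ᵛ_ (VDim⇒Card Σ∞-dim)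

        affine? : Decidable (λ v → W v × ¬ Σ∞ v)
        affine? v = Card-Dec _≟ᵛ_ (VDim⇒Card W-dim) v ×-dec ¬? (Σ∞? v)

        -- A failed inclusion does not by itself name a vector; a search through the finite space
        -- finds one, since `W` and `Σ∞` are decidable.
        affine-vector : ∃ λ w → W w × ¬ Σ∞ w
        affine-vector with any? affine? (allVec _)
        ... | yes p = let w , _ , Ww = find p in w , Ww
        ... | no ¬p = contradiction
          (λ v Wv → decidable-stable (Σ∞? v)
                      (λ v∉ → ¬p (Any.map (λ v≡x → subst (λ x → W x × ¬ Σ∞ x) v≡x (Wv , v∉)) (allVec-complete v)))) W⊈Σ∞

        base-spec : ∃ λ p → Σ∞ p × W (e ⊕ p)
        base-spec =
          let w , Ww , w∉ = affine-vector
              p , c , Σp , _ , eq = affine-coordinates w∉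
          in p , Σp , subst W eq (W.·-closed c Ww)

      base : V
      base = proj₁ base-spec

      base∈Σ∞ : Σ∞ base
      base∈Σ∞ = proj₁ (proj₂ base-spec)

      private
        W∋base : W (e ⊕ base)
        W∋base = proj₂ (proj₂ base-spec)

      ∋pt⇔ : ∀ {s} → Σ∞ s → W (vec (pt s)) ⇔ E (s ∸ base)
      ∋pt⇔ {s} Σs = mk⇔
        (λ W∋s → Equivalence.to (W∩Σ∞ (s ∸ base))
          (subst W same (W.∸-closed (∋pt⇒∋⊕ W-subspace Σs W∋s) W∋base) , ∸-closed Σs base∈Σ∞))
        (λ Es → ∋⊕⇒∋pt W-subspace Σs (subst W
          (trans (⊕-assoc e base (s ∸ base)) (cong (e ⊕_) (⊕-∸ base s)))
          (W.⊕-closed W∋base (proj₁ (Equivalence.from (W∩Σ∞ (s ∸ base)) Es)))))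
        where
        same : (e ⊕ s) ∸ (e ⊕ base) ≡ s ∸ base
        same = trans (⊕-∸-⊕ e s e base) (trans (cong (_⊕ (s ∸ base)) (⊕-inverseʳ e)) (⊕-identityˡ (s ∸ base)))

    -- Sets of plane points are counted in two pieces: those at infinity by their index, the affine
    -- ones by their coordinates in `Σ∞`.
    Card-⊎ : ∀ {X : Set} {A : Point ⊎ X → Set} {k} (xs : List X) (ss : List V) → length xs ℕ.+ length ss ≡ k →
      Unique xs → Unique ss → (∀ {s} → s ∈ ss → Σ∞ s) →
      (∀ x → (x ∈ xs) ⇔ A (inj₂ x)) →
      (∀ {Q} → A (inj₁ Q) → ¬ Σ∞ (vec Q)) →
      (∀ {s} → Σ∞ s → (s ∈ ss) ⇔ A (inj₁ (pt s))) →
      Card A k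
    Card-⊎ {X} {A} xs ss length-xs+ss xs-unique ss-unique ss⊆Σ∞ xs⇔ A-affine ss⇔ =
        infinite ++ affine
      , Unique.++⁺ (Unique.map⁺ inj₂-injective xs-unique)
          (unique-map (λ s∈ t∈ eq → pt-injective (ss⊆Σ∞ s∈) (ss⊆Σ∞ t∈) (inj₁-injective eq)) ss-unique)
          disjoint
      , trans (length-++ infinite)
          (trans (cong₂ ℕ._+_ (length-map inj₂ xs) (length-map (inj₁ ∘ pt) ss)) length-xs+ss)
      , λ y → mk⇔ to (from y)
      where
      infinite affine : List (Point ⊎ X)
      infinite = map inj₂ xs
      affine   = map (inj₁ ∘ pt) ss
      disjoint : ∀ {y} → ¬ (y ∈ infinite × y ∈ affine)
      disjoint (y∈ , y∈′) with _ , _ , refl ← ∈-map⁻ inj₂ y∈ with _ , _ , () ← ∈-map⁻ (inj₁ ∘ pt) y∈′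
      to : ∀ {y} → y ∈ infinite ++ affine → A y
      to y∈ with ∈-++⁻ infinite y∈
      ... | inj₁ y∈ = let x , x∈ , y≡ = ∈-map⁻ inj₂ y∈ in subst A (sym y≡) (Equivalence.to (xs⇔ x) x∈)
      ... | inj₂ y∈ = let s , s∈ , y≡ = ∈-map⁻ (inj₁ ∘ pt) y∈ in
        subst A (sym y≡) (Equivalence.to (ss⇔ (ss⊆Σ∞ s∈)) s∈)
      from : ∀ y → A y → y ∈ infinite ++ affine
      from (inj₂ x) Ax = ∈-++⁺ˡ (∈-map⁺ inj₂ (Equivalence.from (xs⇔ x) Ax))
      from (inj₁ Q) AQ = let s , Σs , pt≡ = pt-surjective (A-affine AQ) in
        ∈-++⁺ʳ infinite (subst (λ P → inj₁ P ∈ affine) pt≡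
          (∈-map⁺ (inj₁ ∘ pt) (Equivalence.from (ss⇔ Σs) (subst (A ∘ inj₁) (sym pt≡) AQ))))

-- The point set B* in affine coordinates.

module UnitalConstruction (𝔽 : FiniteField) (m : ℕ) (1≤m : 1 ≤ m) where
  open FiniteField 𝔽 renaming (Carrier to F)
  open Geometry 𝔽 (suc (4 ℕ.* m))
  open Vectors 𝔽
  open Subspaces 𝔽 (suc (4 ℕ.* m))
  open AffineCoordinates 𝔽 (4 ℕ.* m)

  n : ℕ
  n = order ℕ.^ m

  power : ∀ k → order ℕ.^ (k ℕ.* m) ≡ n ℕ.^ k
  power k = trans (cong (order ℕ.^_) (ℕ.*-comm k m)) (sym (ℕ.^-*-assoc order m k))

  power-2 : order ℕ.^ (2 ℕ.* m) ≡ n ℕ.* n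
  power-2 = trans (power 2) (cong (n ℕ.*_) (ℕ.*-identityʳ n))

  power-4 : order ℕ.^ (4 ℕ.* m) ≡ (n ℕ.* n) ℕ.* (n ℕ.* n)
  power-4 = trans (power 4) (arith n)
    where
    arith : ∀ n → n ℕ.* (n ℕ.* (n ℕ.* (n ℕ.* 1))) ≡ (n ℕ.* n) ℕ.* (n ℕ.* n)
    arith = solve-∀

  1<n : 1 < n
  1<n = ℕ.≤-trans 1<order (subst (ℕ._≤ n) (ℕ.*-identityʳ order) (ℕ.^-monoʳ-≤ order {{ℕ.>-nonZero (ℕ.<⇒≤ 1<order)}} 1≤m))

  _≟ᴾ_ : DecidableEquality Point
  P ≟ᴾ Q = map′ vec-injective (cong vec) (vec P ≟ᵛ vec Q)

  module Setting
    (Σ∞ : VSet) (Σ∞-dim : VDim (4 ℕ.* m) Σ∞) (𝒮 : Spread Σ∞ (2 ℕ.* m)) (z : Fin (Spread.size 𝒮))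
    (𝒱 : VSet) (𝒱-dim : VDim m 𝒱) (𝒱⊆z : 𝒱 ⊆ Spread.elt 𝒮 z)
    (Γ : VSet) (Γ-dim : VDim (3 ℕ.* m) Γ) (Γ⊆Σ∞ : Γ ⊆ Σ∞) (𝒱-Γ-disjoint : Disjoint 𝒱 Γ)
    (Γ′ : VSet) (Γ′-dim : VDim (suc (3 ℕ.* m)) Γ′) (Γ′∩Σ∞ : ∀ v → (Γ′ v × Σ∞ v) ⇔ Γ v)
    (B : Point → Set) (minimal : Plane.MinimalBlocking m Σ∞ 𝒮 z 𝒱 Γ Γ′ B)
    (B-card : Card B (order ℕ.^ (2 ℕ.* m))) (P₀ : Point) (P₀∈B : B P₀)
    where

    open Spread 𝒮
    open Plane m Σ∞ 𝒮

    B⊆Γ′ : ∀ {P} → B P → Γ′ (vec P)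
    B⊆Γ′ {P} BP = proj₁ (proj₁ minimal P BP)

    B-affine : ∀ {P} → B P → ¬ Σ∞ (vec P)
    B-affine {P} BP ΣP = proj₂ (proj₁ minimal P BP) (Equivalence.to (Γ′∩Σ∞ (vec P)) (B⊆Γ′ BP , ΣP))

    -- An origin in `B`, hence in `Γ′`, makes the coordinates of all points of `B` lie in `Γ`, the
    -- complement of 𝒱 used below.
    open Coordinates Σ∞ Σ∞-dim P₀ (B-affine P₀∈B)

    Γ′-subspace : IsSubspace Γ′
    Γ′-subspace = VDim⇒IsSubspace Γ′-dim

    elt-subspace : ∀ i → IsSubspace (elt i)
    elt-subspace i = VDim⇒IsSubspace (eltDim i)

    module Σ∞ = IsSubspace Σ∞-subspace
    module Γ = IsSubspace (VDim⇒IsSubspace Γ-dim)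
    module 𝒱 = IsSubspace (VDim⇒IsSubspace 𝒱-dim)
    module Elt i = IsSubspace (elt-subspace i)

    𝒱⊆Σ∞ : ∀ {v} → 𝒱 v → Σ∞ v
    𝒱⊆Σ∞ 𝒱v = eltSub z _ (𝒱⊆z _ 𝒱v)

    elt-cover : ∀ {v} → Σ∞ v → v ≢ zeroV → ∃ λ i → elt i v
    elt-cover {v} Σv v≢0 with P , c , c≢0 , refl ← point-of v v≢0
                         with i , i∋P ← cover P (Σ∞.·-reflects c≢0 Σv) = i , Elt.·-closed i c i∋P

    elt-disjoint : ∀ {v i j} → v ≢ zeroV → elt i v → elt j v → i ≡ j
    elt-disjoint {v} {i} {j} v≢0 i∋v j∋v with P , c , c≢0 , refl ← point-of v v≢0 =
      disj P i j (Elt.·-reflects i c≢0 i∋v) (Elt.·-reflects j c≢0 j∋v)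

    𝒱∩Γ-trivial : ∀ {v} → 𝒱 v → Γ v → v ≡ zeroV
    𝒱∩Γ-trivial {v} 𝒱v Γv with v ≟ᵛ zeroV
    ... | yes v≡0 = v≡0
    ... | no v≢0 with P , c , c≢0 , refl ← point-of v v≢0 =
      contradiction (𝒱.·-reflects c≢0 𝒱v , Γ.·-reflects c≢0 Γv) (𝒱-Γ-disjoint P)

    -- The difference of two representations lies in 𝒱 and in `Γ`. Geometrically, cones over
    -- different points of `B` share no affine point, so B* has n · n² of them.
    sum-unique : ∀ {v g w h} → 𝒱 v → Γ g → 𝒱 w → Γ h → v ⊕ g ≡ w ⊕ h → v ≡ w × g ≡ h
    sum-unique {v} {g} {w} {h} 𝒱v Γg 𝒱w Γh eq = ∸≡0⇒≡ v w v-w≡0 , sym (∸≡0⇒≡ h g (trans (sym diff) v-w≡0))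
      where
      diff : v ∸ w ≡ h ∸ g
      diff = difference v g w h eq
      v-w≡0 : v ∸ w ≡ zeroV
      v-w≡0 = 𝒱∩Γ-trivial (𝒱.∸-closed 𝒱v 𝒱w) (subst Γ (sym diff) (Γ.∸-closed Γh Γg))

    B? : Decidable B
    B? = Card-Dec _≟ᴾ_ B-card

    G : List V
    G = filter (B? ∘ pt) S

    ∈G⁻ : ∀ {g} → g ∈ G → Σ∞ g × B (pt g)
    ∈G⁻ g∈ = let g∈S , Bg = ∈-filter⁻ (B? ∘ pt) {xs = S} g∈ in ∈S⇒Σ∞ g∈S , Bg

    ∈G⁺ : ∀ {g} → Σ∞ g → B (pt g) → g ∈ G
    ∈G⁺ Σg Bg = ∈-filter⁺ (B? ∘ pt) (Σ∞⇒∈S Σg) Bg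

    G⊆Γ : ∀ {g} → g ∈ G → Γ g
    G⊆Γ g∈ = let Σg , Bg = ∈G⁻ g∈ in
      Equivalence.to (Γ′∩Σ∞ _) (IsSubspace.⊕-reflectsʳ Γ′-subspace (B⊆Γ′ P₀∈B) (∋pt⇒∋⊕ Γ′-subspace Σg (B⊆Γ′ Bg)) , Σg)

    G-unique : Unique G
    G-unique = Unique.filter⁺ (B? ∘ pt) S-unique

    length-G : length G ≡ n ℕ.* n
    length-G = let Bs , Bs-unique , Bs-length , Bs⇔B = B-card in begin
      length G              ≡⟨ length-map pt G ⟨
      length (map pt G)     ≡⟨ length-unique
                                 (unique-map (λ g∈ h∈ → pt-injective (proj₁ (∈G⁻ g∈)) (proj₁ (∈G⁻ h∈)))
                                   G-unique)
                                 Bs-unique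
                                 (λ P∈ → let g , g∈ , P≡ = ∈-map⁻ pt P∈ in
                                   Equivalence.from (Bs⇔B _) (subst B (sym P≡) (proj₂ (∈G⁻ g∈))))
                                 (λ {P} P∈ → let BP = Equivalence.to (Bs⇔B P) P∈ ; g , Σg , pt≡ = pt-surjective (B-affine BP) in
                                   subst (_∈ map pt G) pt≡ (∈-map⁺ pt (∈G⁺ Σg (subst B (sym pt≡) BP)))) ⟩
      length Bs             ≡⟨ Bs-length ⟩
      order ℕ.^ (2 ℕ.* m)   ≡⟨ power-2 ⟩
      n ℕ.* n               ∎
      where open ≡-Reasoning

    𝒱s : List V
    𝒱s = proj₁ (VDim⇒Card 𝒱-dim)

    𝒱s-unique : Unique 𝒱s
    𝒱s-unique = proj₁ (proj₂ (VDim⇒Card 𝒱-dim))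

    length-𝒱s : length 𝒱s ≡ n
    length-𝒱s = proj₁ (proj₂ (proj₂ (VDim⇒Card 𝒱-dim)))

    ∈𝒱s⇒𝒱 : ∀ {v} → v ∈ 𝒱s → 𝒱 v
    ∈𝒱s⇒𝒱 {v} = Equivalence.to (proj₂ (proj₂ (proj₂ (VDim⇒Card 𝒱-dim))) v)

    𝒱⇒∈𝒱s : ∀ {v} → 𝒱 v → v ∈ 𝒱s
    𝒱⇒∈𝒱s {v} = Equivalence.from (proj₂ (proj₂ (proj₂ (VDim⇒Card 𝒱-dim))) v)

    U : List V
    U = cartesianProductWith _⊕_ 𝒱s G

    ∈U⁻ : ∀ {u} → u ∈ U → ∃ λ v → ∃ λ g → 𝒱 v × g ∈ G × u ≡ v ⊕ g
    ∈U⁻ u∈ = let v , g , v∈ , g∈ , u≡ = ∈-cartesianProductWith⁻ _⊕_ 𝒱s G u∈ in v , g , ∈𝒱s⇒𝒱 v∈ , g∈ , u≡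

    ∈U⁺ : ∀ {v g} → 𝒱 v → g ∈ G → v ⊕ g ∈ U
    ∈U⁺ 𝒱v g∈ = ∈-cartesianProductWith⁺ _⊕_ (𝒱⇒∈𝒱s 𝒱v) g∈

    U⊆Σ∞ : ∀ {u} → u ∈ U → Σ∞ u
    U⊆Σ∞ u∈ with v , g , 𝒱v , g∈ , refl ← ∈U⁻ u∈ = Σ∞.⊕-closed (𝒱⊆Σ∞ 𝒱v) (proj₁ (∈G⁻ g∈))

    U-unique : Unique U
    U-unique = unique-cartesianProductWith _⊕_
      (λ v∈ g∈ w∈ h∈ → sum-unique (∈𝒱s⇒𝒱 v∈) (G⊆Γ g∈) (∈𝒱s⇒𝒱 w∈) (G⊆Γ h∈)) 𝒱s-unique G-unique

    length-U : length U ≡ n ℕ.* (n ℕ.* n)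
    length-U = begin
      length U                 ≡⟨ length-cartesianProductWith _⊕_ 𝒱s G ⟩
      length 𝒱s ℕ.* length G   ≡⟨ cong₂ ℕ._*_ length-𝒱s length-G ⟩
      n ℕ.* (n ℕ.* n)          ∎
      where open ≡-Reasoning

    U⇒BStar : ∀ {s} → s ∈ U → BStar z 𝒱 B (inj₁ (pt s))
    U⇒BStar s∈ =
      let v , g , 𝒱v , g∈ , s≡ = ∈U⁻ s∈
          Σg , Bg = ∈G⁻ g∈
          b , c , eq = pt-⊕ (𝒱⊆Σ∞ 𝒱v) Σg
      in pt g , Bg , b · v , c · vec (pt g) , 𝒱.·-closed b 𝒱v , (c , refl) , trans (cong (vec ∘ pt) s≡) eq

    BStar⇒U : ∀ {s} → Σ∞ s → BStar z 𝒱 B (inj₁ (pt s)) → s ∈ U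
    BStar⇒U {s} Σs (P , BP , v , w , 𝒱v , (d , w≡) , pt-s≡) =
      let g , Σg , pt-g≡ = pt-surjective (B-affine BP)
          b , s≡ = pt-⊕⁻ Σs (𝒱⊆Σ∞ 𝒱v) Σg
                     (trans pt-s≡ (cong (v ⊕_) (trans w≡ (cong (λ Q → d · vec Q) (sym pt-g≡)))))
      in subst (_∈ U) (sym s≡) (∈U⁺ (𝒱.·-closed b 𝒱v) (∈G⁺ Σg (subst B (sym pt-g≡) BP)))

    -- Parallel classes from the spread, and tangents from minimality.

    R : Fin size → V → V → Set
    R i u v = elt i (v ∸ u)

    R? : ∀ i u v → Dec (R i u v)
    R? i u v = Card-Dec _≟ᵛ_ (VDim⇒Card (eltDim i)) (v ∸ u)

    R-refl : ∀ {i u} → R i u u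
    R-refl {i} {u} = subst (elt i) (sym (⊕-inverseʳ u)) (Elt.0-closed i)

    R-sym : ∀ {i u v} → R i u v → R i v u
    R-sym {i} {u} {v} r = subst (elt i) (⊖-∸ v u) (Elt.⊖-closed i r)

    R-trans : ∀ {i u v w} → R i u v → R i v w → R i u w
    R-trans {i} {u} {v} {w} r r′ = subst (elt i) (∸-trans u v w) (Elt.⊕-closed i r r′)

    class-size : ∀ i {u} → u ∈ S → # (R? i u) S ≡ n ℕ.* n
    class-size i {u} u∈ with Xs , Xs-unique , Xs-length , Xs⇔ ← VDim⇒Card (eltDim i) = begin
      # (R? i u) S            ≡⟨ length-unique (Unique.filter⁺ (R? i u) S-unique)
                                   (Unique.map⁺ (⊕-cancelˡ u _ _) Xs-unique)
                                   (λ {v} v∈ → let _ , r = ∈-filter⁻ (R? i u) {xs = S} v∈ in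
                                     subst (_∈ map (u ⊕_) Xs) (⊕-∸ u v) (∈-map⁺ (u ⊕_) (Equivalence.from (Xs⇔ _) r)))
                                   translate ⟩
      length (map (u ⊕_) Xs)  ≡⟨ length-map (u ⊕_) Xs ⟩
      length Xs               ≡⟨ Xs-length ⟩
      order ℕ.^ (2 ℕ.* m)     ≡⟨ power-2 ⟩
      n ℕ.* n                 ∎
      where
      open ≡-Reasoning
      translate : ∀ {v} → v ∈ map (u ⊕_) Xs → v ∈ filter (R? i u) S
      translate v∈ with x , x∈ , refl ← ∈-map⁻ (u ⊕_) v∈ =
        let i∋x = Equivalence.to (Xs⇔ x) x∈ in
        ∈-filter⁺ (R? i u) (Σ∞⇒∈S (Σ∞.⊕-closed (∈S⇒Σ∞ u∈) (eltSub i x i∋x)))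
          (subst (elt i) (sym (⊕-∸-cancel u x)) i∋x)

    join-unique : ∀ {u v} → u ∈ S → v ∈ S → u ≢ v → # (λ i → R? i u v) (allFin size) ≡ 1
    join-unique {u} {v} u∈ v∈ u≢v =
      let i , i∋ = elt-cover (Σ∞.∸-closed (∈S⇒Σ∞ v∈) (∈S⇒Σ∞ u∈)) v∸u≢0 in
      #-once (λ i → R? i u v) (Unique.allFin⁺ size) (∈-allFin i) i∋ (λ _ j∋ → elt-disjoint v∸u≢0 j∋ i∋)
      where
      v∸u≢0 : v ∸ u ≢ zeroV
      v∸u≢0 eq = u≢v (sym (∸≡0⇒≡ v u eq))

    -- An element of ℱ(𝒱) on I(x) meeting B only in P is the trace on Γ′ of a line of
    -- Π(𝒮) through x which is tangent to B*.
    tangent : ∀ {u} → u ∈ U → ∃ λ i → i ≢ z × (∀ {v} → v ∈ U → R i u v → v ≡ u)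
    tangent u∈ with v , g , 𝒱v , g∈ , refl ← ∈U⁻ u∈
      with Σg , Bg ← ∈G⁻ g∈
      with W , (W-dim , _ , _ , x , x≢z , I⊆W) , W∋g , only ← proj₂ (proj₂ minimal) (pt g) Bg =
      x , x≢z , unique
      where
      W-subspace : IsSubspace W
      W-subspace = VDim⇒IsSubspace W-dim
      unique : ∀ {w} → w ∈ U → R x (v ⊕ g) w → w ≡ v ⊕ g
      unique w∈ r with v′ , g′ , 𝒱v′ , g′∈ , refl ← ∈U⁻ w∈ =
        cong₂ _⊕_ (∸≡0⇒≡ v′ v v′-v≡0) g′≡g
        where
        Σg′ = proj₁ (∈G⁻ g′∈)
        d = (v′ ⊕ g′) ∸ (v ⊕ g)
        d≡ : d ≡ (v′ ∸ v) ⊕ (g′ ∸ g)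
        d≡ = ⊕-∸-⊕ v′ g′ v g
        -- Removing the 𝒱-part of `d`, which lies in `elt x`, leaves a vector of ⟨x, 𝒱⟩ that also
        -- lies in `Γ`. Since `I(x)` is contained in `W`, the point `pt g′` is on `W`.
        g′-g∈I : I 𝒱 Γ x (g′ ∸ g)
        g′-g∈I = (d , ⊖ (v′ ∸ v) , r , 𝒱.⊖-closed (𝒱.∸-closed 𝒱v′ 𝒱v) ,
                   trans (sym (⊕-∸-cancel (v′ ∸ v) (g′ ∸ g))) (cong (_∸ (v′ ∸ v)) (sym d≡)))
               , Γ.∸-closed (G⊆Γ g′∈) (G⊆Γ g∈)
        W∋g′ : W (vec (pt g′))
        W∋g′ = ∋⊕⇒∋pt W-subspace Σg′ (subst W
          (trans (⊕-assoc e g (g′ ∸ g)) (cong (e ⊕_) (⊕-∸ g g′)))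
          (IsSubspace.⊕-closed W-subspace (∋pt⇒∋⊕ W-subspace Σg W∋g) (I⊆W _ g′-g∈I)))
        g′≡g : g′ ≡ g
        g′≡g = pt-injective Σg′ Σg (only (pt g′) (proj₂ (∈G⁻ g′∈)) W∋g′)
        d≡v′-v : d ≡ v′ ∸ v
        d≡v′-v = trans d≡ (trans (cong ((v′ ∸ v) ⊕_) (≡⇒∸≡0 g′≡g)) (⊕-identityʳ (v′ ∸ v)))
        -- Now `d` lies both in `elt x` and in 𝒱, hence in `elt z`; distinct spread elements share
        -- only the zero vector.
        v′-v≡0 : v′ ∸ v ≡ zeroV
        v′-v≡0 with (v′ ∸ v) ≟ᵛ zeroV
        ... | yes eq = eq
        ... | no ne  = contradiction
          (elt-disjoint ne (subst (elt x) d≡v′-v r) (𝒱⊆z _ (𝒱.∸-closed 𝒱v′ 𝒱v))) x≢z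

    -- Intersections of B* with the lines of the plane.

    open BruenThas _≟ᵛ_ n 1<n z S U (trans length-S power-4) U-unique length-U (Σ∞⇒∈S ∘ U⊆Σ∞)
      R R? R-refl R-sym R-trans S-unique class-size join-unique tangent
      using (secant-or-tangent; class-z-count)

    BStar-card : Card (λ x → ValidPt x × BStar z 𝒱 B x) (n ℕ.^ 3 ℕ.+ 1)
    BStar-card = Card-⊎ (z ∷ []) U size≡ ([] ∷ []) U-unique U⊆Σ∞
      (λ i → mk⇔ (λ { (here i≡z) → tt , i≡z }) (λ (_ , i≡z) → here i≡z))
      proj₁
      (λ Σs → mk⇔ (λ s∈ → pt-affine Σs , U⇒BStar s∈) (λ (_ , Bs) → BStar⇒U Σs Bs))
      where
      arith : ∀ n → suc (n ℕ.* (n ℕ.* n)) ≡ n ℕ.* (n ℕ.* (n ℕ.* 1)) ℕ.+ 1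
      arith = solve-∀
      size≡ : suc (length U) ≡ n ℕ.^ 3 ℕ.+ 1
      size≡ = trans (cong suc length-U) (arith n)

    module AffineLine
      (L : PlanePt → Set) (W : VSet) (i : Fin size) (W-dim : VDim (suc (2 ℕ.* m)) W) (W⊈Σ∞ : ¬ (W ⊆ Σ∞))
      (W∩Σ∞ : ∀ v → (W v × Σ∞ v) ⇔ elt i v) (L⇔ : ∀ x → L x ⇔ affLine W i x)
      where

      open AffineTrace W-dim W⊈Σ∞ W∩Σ∞ renaming (base to p; base∈Σ∞ to Σp; ∋pt⇔ to W∋pt⇔R)

      Us : List V
      Us = filter (R? i p) U

      Common : PlanePt → Set
      Common x = ValidPt x × BStar z 𝒱 B x × L x

      Us⊆Σ∞ : ∀ {s} → s ∈ Us → Σ∞ s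
      Us⊆Σ∞ s∈ = U⊆Σ∞ (proj₁ (∈-filter⁻ (R? i p) {xs = U} s∈))

      Us⇒Common : ∀ {s} → Σ∞ s → s ∈ Us → Common (inj₁ (pt s))
      Us⇒Common {s} Σs s∈ =
        let s∈U , r = ∈-filter⁻ (R? i p) {xs = U} s∈
        in pt-affine Σs , U⇒BStar s∈U , Equivalence.from (L⇔ (inj₁ (pt s))) (Equivalence.from (W∋pt⇔R Σs) r)

      Common⇒Us : ∀ {s} → Σ∞ s → Common (inj₁ (pt s)) → s ∈ Us
      Common⇒Us {s} Σs (_ , Bs , Ls) =
        ∈-filter⁺ (R? i p) (BStar⇒U Σs Bs) (Equivalence.to (W∋pt⇔R Σs) (Equivalence.to (L⇔ (inj₁ (pt s))) Ls))

      Common-inj₂ : ∀ j → Common (inj₂ j) ⇔ (j ≡ z × j ≡ i)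
      Common-inj₂ j = mk⇔
        (λ (_ , j≡z , Lj) → j≡z , Equivalence.to (L⇔ (inj₂ j)) Lj)
        (λ (j≡z , j≡i) → tt , j≡z , Equivalence.from (L⇔ (inj₂ j)) j≡i)

      common-card : ∀ {k} is → Unique is → (∀ j → (j ∈ is) ⇔ (j ≡ z × j ≡ i)) →
                    length is ℕ.+ length Us ≡ k → Card Common k
      common-card is is-unique is⇔ size≡ = Card-⊎ is Us size≡ is-unique (Unique.filter⁺ (R? i p) U-unique)
        Us⊆Σ∞
        (λ j → mk⇔ (Equivalence.from (Common-inj₂ j) ∘ Equivalence.to (is⇔ j))
                   (Equivalence.from (is⇔ j) ∘ Equivalence.to (Common-inj₂ j)))
        proj₁
        (λ Σs → mk⇔ (Us⇒Common Σs) (Common⇒Us Σs))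

      intersection : Card Common 1 ⊎ Card Common (n ℕ.+ 1)
      intersection = by-class (i Fin.≟ z)
        where
        by-class : Dec (i ≡ z) → Card Common 1 ⊎ Card Common (n ℕ.+ 1)
        -- The n affine points are joined by `z` itself. In the other case the point at infinity of
        -- the line is not in B*, and the affine count is already final.
        by-class (yes i≡z) = inj₂ (common-card (z ∷ []) ([] ∷ [])
          (λ j → mk⇔ (λ { (here j≡z) → j≡z , trans j≡z (sym i≡z) }) (λ (j≡z , _) → here j≡z))
          (trans (cong suc (subst (λ j → # (R? j p) U ≡ n) (sym i≡z) (class-z-count (Σ∞⇒∈S Σp)))) (ℕ.+-comm 1 n)))
        by-class (no i≢z) = Data.Sum.map (common-card [] [] empty)
          (λ a≡1+n → common-card [] [] empty (trans a≡1+n (ℕ.+-comm 1 n))) (secant-or-tangent i≢z (Σ∞⇒∈S Σp))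
          where
          empty : ∀ j → (j ∈ []) ⇔ (j ≡ z × j ≡ i)
          empty j = mk⇔ (λ ()) (λ (j≡z , j≡i) → contradiction (trans (sym j≡i) j≡z) i≢z)

    unital : IsUnital (BStar z 𝒱 B)
    unital = BStar-card , intersections
      where
      intersections : ∀ L → PiLine L → Card _ 1 ⊎ Card _ (n ℕ.+ 1)
      intersections L (inj₁ L⇔) = inj₁ (Card-⊎ (z ∷ []) [] refl ([] ∷ []) [] (λ ())
        (λ i → mk⇔ (λ { (here i≡z) → tt , i≡z , Equivalence.from (L⇔ (inj₂ i)) tt }) (λ (_ , i≡z , _) → here i≡z))
        proj₁
        (λ {s} _ → mk⇔ (λ ()) (λ (_ , _ , Ls) → contradiction (Equivalence.to (L⇔ (inj₁ (pt s))) Ls) λ ())))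
      intersections L (inj₂ (W , i , W-dim , W⊈Σ∞ , W∩Σ∞ , L⇔)) =
        AffineLine.intersection L W i W-dim W⊈Σ∞ W∩Σ∞ L⇔

open import Data.Nat using (_*_; _^_)

theorem2 : (𝔽 : FiniteField) (m : ℕ) → 1 ≤ m →
    let open FiniteField 𝔽 using (order)
        open Geometry 𝔽 (suc (4 * m))
    in (Σ∞ : VSet) → VDim (4 * m) Σ∞ →
       (𝒮 : Spread Σ∞ (2 * m)) →
       let open Spread 𝒮
           open Plane m Σ∞ 𝒮
       in (z : Fin size) →
          (𝒱 : VSet) → VDim m 𝒱 → 𝒱 ⊆ elt z →
          (Γ : VSet) → VDim (3 * m) Γ → Γ ⊆ Σ∞ → Disjoint 𝒱 Γ →
          (Γ' : VSet) → VDim (suc (3 * m)) Γ' →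
          (∀ v → (Γ' v × Σ∞ v) ⇔ Γ v) →
          (B : Point → Set) → MinimalBlocking z 𝒱 Γ Γ' B →
          Card B (order ^ (2 * m)) →
          IsUnital (BStar z 𝒱 B)
theorem2 𝔽 m 1≤m Σ∞ Σ∞-dim 𝒮 z 𝒱 𝒱-dim 𝒱⊆z Γ Γ-dim Γ⊆Σ∞ disjoint Γ′ Γ′-dim Γ′∩Σ∞ B minimal B-card@(Bs , _ , Bs-length , Bs⇔B) =
  -- The size of `B` is a positive power, which supplies the affine origin.
  let P₀ , P₀∈Bs = inhabited Bs (subst (1 ≤_) (sym Bs-length)
                     (ℕ.m^n>0 (FiniteField.order 𝔽) {{ℕ.>-nonZero (ℕ.<⇒≤ (Vectors.1<order 𝔽))}} (2 * m)))
  in UnitalConstruction.Setting.unital 𝔽 m 1≤m Σ∞ Σ∞-dim 𝒮 z 𝒱 𝒱-dim 𝒱⊆z Γ Γ-dim Γ⊆Σ∞ disjoint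
       Γ′ Γ′-dim Γ′∩Σ∞ B minimal B-card P₀ (Equivalence.to (Bs⇔B P₀) P₀∈Bs)
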